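{- For $n\in\mathbb{N}$, let $F(n)=\#\{(x,y)\in\mathbb{Z}^2 : x^2+xy+y^2\le n\}$ be the number of lattice points contained in the elliptical region $x^2+xy+y^2\le n$. Then $$F(n) = 6\,\mathcal{N}_{n,0,0,1,3}+1.$$
   Context: $\mathbb{N}$ denotes the set of positive integers and $\lfloor\cdot\rfloor$ the floor function. For $n,m\in\mathbb{N}$, $r\in\mathbb{Z}$ and $\alpha,\nu\in\mathbb{R}$, define $$\mathcal{N}_{n,\alpha,\nu,r,m}=\#\left\{k\in\mathbb{Z} : 1\le k\le n,\ \left\lfloor\frac{n-\nu}{k}+\alpha\right\rfloor\equiv r \pmod m\right\}.$$ -}

module Defs where

open import Data.Fin.Base using (Fin)
open import Data.Integer.Base as ℤ using (ℤ; +_; 1ℤ)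
open import Data.Integer.Divisibility.Signed using (_∣_; _∣?_)
open import Data.List.Base using (length; filter; upTo)
open import Data.Nat.Base using (ℕ; suc; NonZero)
open import Data.Product.Base using (Σ; _×_; _,_)
open import Data.Rational.Base using (ℚ; _/_; _+_; _-_; _*_; floor)
open import Function.Bundles using (_↔_)
open import Relation.Nullary.Decidable using (Dec)

infix 4 _≡_[mod_] _≡?_[mod_] #_≐_

_≡_[mod_] : ℤ → ℤ → ℕ → Set
a ≡ r [mod m ] = + m ∣ a ℤ.- r

_≡?_[mod_] : ∀ a r m → Dec (a ≡ r [mod m ])
a ≡? r [mod m ] = + m ∣? a ℤ.- r

⌊[_-_]/_+_⌋ : ℕ → ℚ → (k : ℕ) → .{{NonZero k}} → ℚ → ℤ
⌊[ n - ν ]/ k + α ⌋ = floor ((+ n / 1 - ν) * (1ℤ / k) + α)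

-- The index k, 1 ≤ k ≤ n, is written as suc i with 0 ≤ i < n.
-- The parameters α and ν are rational, there being no type of reals.
𝒩 : (n : ℕ) → .{{NonZero n}} → (α ν : ℚ) → (r : ℤ) →
    (m : ℕ) → .{{NonZero m}} → ℕ
𝒩 n α ν r m =
  length (filter (λ i → ⌊[ n - ν ]/ suc i + α ⌋ ≡? r [mod m ]) (upTo n))

-- # A ≐ c says that A is finite with exactly c elements.
#_≐_ : Set → ℕ → Set
# A ≐ c = A ↔ Fin c

-- The order on ℤ is proof-irrelevant, so distinct elements of this type
-- are distinct lattice points.
EllipsePoint : ℕ → Set
EllipsePoint n =
  Σ (ℤ × ℤ) λ (x , y) → x ℤ.* x ℤ.+ x ℤ.* y ℤ.+ y ℤ.* y ℤ.≤ + n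

{-# OPTIONS --safe #-}

-- Let ζ be a primitive sixth root of unity, so that x² + xy + y² is the norm of x + yζ, and
-- let χ be the non-trivial character modulo 3. For j ≥ 1 the number r(j) of elements of ℤ[ζ]
-- of norm j is 6 σ(j), where σ(j) = Σ_{k ∣ j} χ(j/k): both r and 6σ satisfy the recursion
-- f(pj) = f(j) + χ(p) (f(j) - f(j/p)) at every prime p, with f(j/p) = 0 when p ∤ j, and they
-- agree at j = 1. For r it comes from the decomposition of p in ℤ[ζ]. If p ≡ 1 mod 3, then
-- multiplication by ζ acts on the p + 1 points of the projective line over 𝔽ₚ with order 3,
-- hence has a fixed point, which is a non-trivial zero of the norm modulo p; Fermat descent
-- turns such a zero into an element of norm p. If p ≡ 2 mod 3, the same descent would yield
-- a norm ≡ 2 mod 3, so p is inert.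
-- Finally σ(n) is the increment, from n - 1 to n, of the number of k with ⌊n/k⌋ ≡ 1 mod 3.
module Submission where

open import Defs
open import Axiom.UniquenessOfIdentityProofs using (module Decidable⇒UIP)
open import Data.Bool.Base using (if_then_else_; true; false)
open import Data.Bool.Properties using (T-irrelevant)
open import Data.Empty using (⊥-elim)
open import Data.Fin.Base as Fin using (Fin; punchIn; punchOut; toℕ; fromℕ<)
open import Data.Fin.Patterns using (0F; 1F; 2F; 3F; 4F; 5F)
open import Data.Fin.Properties as Fin using (+↔⊎; 0↔⊥; 1↔⊤; any?; toℕ<n; toℕ-fromℕ<; toℕ-injective)
open import Data.Integer.Base as ℤ using (ℤ; +_; -[1+_]; 0ℤ; 1ℤ; -1ℤ; ∣_∣; _+_; _*_; _-_; -_)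
open import Data.Integer.DivMod using (_%ℕ_; _/ℕ_; n%ℕd<d; a≡a%ℕn+[a/ℕn]*n; div-pos-is-/ℕ)
open import Data.Integer.Divisibility.Signed
import Data.Integer.Properties as ℤ
open import Data.Integer.Tactic.RingSolver using (solve-∀)
open import Data.List.Base using (length; filter; applyUpTo; []; _∷_)
open import Data.List.Relation.Unary.All using (_∷_)
open import Data.Nat.Base as ℕ using (ℕ; zero; suc; NonZero; z≤n; s≤s; _≤_; _<_)
open import Data.Nat.Coprimality using (Coprime; coprime-Bézout; coprime-divisor)
import Data.Nat.Divisibility as ℕ
import Data.Nat.DivMod as ℕ
open import Data.Nat.GCD using (module Bézout)
open import Data.Nat.Induction using (<-rec; <-wellFounded)
open import Data.Nat.ListAction using (product)
open import Data.Nat.Primality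
  using (Prime; prime?; euclidsLemma; prime⇒nonZero; prime⇒nonTrivial; prime⇒irreducible; ¬prime[1])
open import Data.Nat.Primality.Factorisation using (PrimeFactorisation; factorise)
import Data.Nat.Properties as ℕ
import Data.Nat.Tactic.RingSolver as ℕ-Solver
open import Data.Product.Base using (Σ; ∃; _×_; _,_; proj₁; proj₂)
open import Data.Rational.Base as ℚ using (mkℚ; 0ℚ; floor; toℚᵘ)
import Data.Rational.Properties as ℚ
open import Data.Rational.Unnormalised.Base using (mkℚᵘ; *≡*; _≃_)
import Data.Rational.Unnormalised.Properties as ℚᵘ
open import Data.Sum.Base as Sum using (_⊎_; inj₁; inj₂; [_,_]′)
open import Data.Sum.Function.Propositional using (_⊎-↔_)
open import Data.Sum.Properties using (inj₂-injective)
open import Data.Unit.Base using (⊤; tt)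
open import Function.Base using (_∘_; id)
open import Function.Bundles using (_↔_; Inverse; mk↔ₛ′)
open import Function.Construct.Composition using (_↔-∘_)
open import Function.Construct.Identity using (↔-id)
open import Function.Construct.Symmetry using (↔-sym)
open import Function.Related.TypeIsomorphisms using (⊎-assoc)
open import Induction.WellFounded using (Acc; acc)
open import Level using (0ℓ)
open import Relation.Binary.Definitions using (tri<; tri≈; tri>)
open import Relation.Binary.PropositionalEquality
open import Relation.Nullary using (¬_; Dec; yes; no; does; contradiction)
open import Relation.Nullary.Decidable
  using (True; False; toWitness; toWitnessFalse; fromWitness; fromWitnessFalse; from-no; map′; _×-dec_; dec-true; dec-false)
open import Algebra.Properties.CommutativeMonoid.Sum ℕ.+-0-commutativeMonoid
  using (sum; sum-permute; ∑-distrib-+; sum-cong-≗)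

open ≡-Reasoning

-- Finite cardinalities

private variable
  A B : Set
  #A #B #A⊎B : ℤ

module _ {n} (e : (⊤ ⊎ A) ↔ Fin (suc n)) where
  private
    open module E = Inverse e using (to; from; strictlyInverseˡ; strictlyInverseʳ)

    hole : Fin (suc n)
    hole = to (inj₁ tt)

    to-injective : ∀ {x y} → to x ≡ to y → x ≡ y
    to-injective {x} {y} eq =
      trans (sym (strictlyInverseʳ x)) (trans (cong from eq) (strictlyInverseʳ y))

    hole≢ : ∀ a → hole ≢ to (inj₂ a)
    hole≢ a eq with () ← to-injective eq

    preimage : ∀ i → ∃ λ a → to (inj₂ a) ≡ punchIn hole i
    preimage i with from (punchIn hole i) in eq
    ... | inj₁ tt = contradiction (trans (sym (strictlyInverseˡ _)) (cong to eq))
      (Fin.punchInᵢ≢i hole i)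
    ... | inj₂ a  = a , trans (cong to (sym eq)) (strictlyInverseˡ _)

  -- The value `hole` of the extra point is deleted from `Fin (suc n)`; `punchOut` and `punchIn`
  -- close and reopen the gap.
  ↔-remove : A ↔ Fin n
  ↔-remove = mk↔ₛ′ (λ a → punchOut (hole≢ a)) (λ i → proj₁ (preimage i))
    (λ i → trans (Fin.punchOut-cong hole (proj₂ (preimage i))) (Fin.punchOut-punchIn hole))
    (λ a → inj₂-injective (to-injective
       (trans (proj₂ (preimage _)) (Fin.punchIn-punchOut (hole≢ a)))))

-- Finiteness of `B` is not assumed. It is extracted by deleting the `m` known points one at a time.
↔-cancel : ∀ m {n} → (Fin m ⊎ B) ↔ Fin n → ∃ λ k → # B ≐ k × n ≡ m ℕ.+ k
↔-cancel zero e =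
  _ , e ↔-∘ mk↔ₛ′ inj₂ (λ { (inj₁ ()) ; (inj₂ b) → b })
        (λ { (inj₁ ()) ; (inj₂ _) → refl }) (λ _ → refl) , refl
↔-cancel (suc m) {zero}  e with () ← Inverse.to e (inj₁ Fin.zero)
↔-cancel (suc m) {suc n} e =
  let k , B↔ , n≡ = ↔-cancel m (↔-remove (e ↔-∘ (head ↔-∘ ↔-sym (⊎-assoc 0ℓ _ _ _))))
  in k , B↔ , cong suc n≡
  where
  head : ((⊤ ⊎ Fin m) ⊎ B) ↔ (Fin (suc m) ⊎ B)
  head = (↔-sym (+↔⊎ {1} {m}) ↔-∘ (↔-sym 1↔⊤ ⊎-↔ ↔-id _)) ⊎-↔ ↔-id _

-- Cardinalities are compared in ℤ, so that differences and factors χ(p) = -1 can appear in them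
-- without truncated subtraction.
HasCard : Set → ℤ → Set
HasCard A z = ∃ λ c → # A ≐ c × + c ≡ z

card-↔ : A ↔ B → HasCard A #A → HasCard B #A
card-↔ A↔B (c , A↔c , c≡) = c , A↔c ↔-∘ ↔-sym A↔B , c≡

card-⊥ : ¬ A → HasCard A 0ℤ
card-⊥ ¬A = 0 , ↔-sym 0↔⊥ ↔-∘ mk↔ₛ′ ¬A ⊥-elim (λ ()) (λ a → ⊥-elim (¬A a)) , refl

card-⊎ : HasCard A #A → HasCard B #B → HasCard (A ⊎ B) (#A + #B)
card-⊎ (m , A↔ , refl) (n , B↔ , refl) = m ℕ.+ n , ↔-sym +↔⊎ ↔-∘ (A↔ ⊎-↔ B↔) , ℤ.pos-+ m n

card-∸ : HasCard (A ⊎ B) #A⊎B → HasCard A #A → HasCard B (#A⊎B - #A)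
card-∸ (n , AB↔ , refl) (m , A↔ , refl)
  with k , B↔ , refl ← ↔-cancel m (AB↔ ↔-∘ (↔-sym A↔ ⊎-↔ ↔-id _))
  = k , B↔ , trans (cancel (+ m) (+ k)) (cong (_- + m) (sym (ℤ.pos-+ m k)))
  where
  cancel : ∀ x y → y ≡ x + y - x
  cancel = solve-∀

module _ {P : A → Set} (P? : ∀ x → Dec (P x)) where

  -- `True` and `False` are proof-irrelevant, so elements with equal first components are equal even
  -- when `P` is an existential statement or occurs negated.
  Sat Unsat : Set
  Sat   = Σ A λ x → True (P? x)
  Unsat = Σ A λ x → False (P? x)

  Σ-True-≡ : {s t : Sat} → proj₁ s ≡ proj₁ t → s ≡ t
  Σ-True-≡ {_ , p} {_ , q} refl = cong (_ ,_) (T-irrelevant p q)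

  Σ-False-≡ : {s t : Unsat} → proj₁ s ≡ proj₁ t → s ≡ t
  Σ-False-≡ {_ , p} {_ , q} refl = cong (_ ,_) (T-irrelevant p q)

  ↔-split : A ↔ (Sat ⊎ Unsat)
  ↔-split = mk↔ₛ′ (λ x → classify (P? x)) [ proj₁ , proj₁ ]′ to∘from (λ x → forget (P? x))
    where
    classify : ∀ {x} → Dec (P x) → Sat ⊎ Unsat
    classify {x} (yes p) = inj₁ (x , fromWitness p)
    classify {x} (no ¬p) = inj₂ (x , fromWitnessFalse ¬p)
    forget : ∀ {x} (d : Dec (P x)) → [ proj₁ , proj₁ ]′ (classify d) ≡ x
    forget (yes _) = refl
    forget (no _)  = refl
    classify-yes : ∀ {x} (d : Dec (P x)) t → classify d ≡ inj₁ (x , t)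
    classify-yes (yes _) t = cong inj₁ (Σ-True-≡ refl)
    classify-yes (no ¬p) t = contradiction (toWitness t) ¬p
    classify-no : ∀ {x} (d : Dec (P x)) f → classify d ≡ inj₂ (x , f)
    classify-no (yes p) f = contradiction p (toWitnessFalse f)
    classify-no (no _)  f = cong inj₂ (Σ-False-≡ refl)
    to∘from : ∀ s → classify (P? ([ proj₁ , proj₁ ]′ s)) ≡ s
    to∘from (inj₁ (x , t)) = classify-yes (P? x) t
    to∘from (inj₂ (x , f)) = classify-no (P? x) f

-- The ring ℤ[ζ] and its norm form

infixl 7 _·_ _•_
infixl 6 _⊕_
infix 4 _∣ᴱ_ _∣²_

-- (x , y) stands for x + yζ, where ζ is a primitive sixth root of unity: ζ² = ζ - 1.
𝔼 : Set
𝔼 = ℤ × ℤ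

norm : 𝔼 → ℤ
norm (x , y) = x * x + x * y + y * y

_·_ _⊕_ : 𝔼 → 𝔼 → 𝔼
(a , b) · (x , y) = a * x - b * y , a * y + b * x + b * y
(a , b) ⊕ (x , y) = a + x , b + y

-- The roots of X² - X + 1 are ζ and 1 - ζ, so the conjugate of x + yζ is (x + y) - yζ.
conj : 𝔼 → 𝔼
conj (x , y) = x + y , - y

_•_ : ℤ → 𝔼 → 𝔼
c • (x , y) = c * x , c * y

_∣ᴱ_ : 𝔼 → 𝔼 → Set
w ∣ᴱ z = ∃ λ u → w · u ≡ z

_∣²_ : ℤ → 𝔼 → Set
c ∣² (x , y) = (c ∣ x) × (c ∣ y)

norm-· : ∀ w z → norm (w · z) ≡ norm w * norm z
norm-· (a , b) (x , y) = identity a b x y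
  where
  identity : ∀ a b x y → (a * x - b * y) * (a * x - b * y) + (a * x - b * y) * (a * y + b * x + b * y)
    + (a * y + b * x + b * y) * (a * y + b * x + b * y) ≡ (a * a + a * b + b * b)
      * (x * x + x * y + y * y)
  identity = solve-∀

norm-conj : ∀ z → norm (conj z) ≡ norm z
norm-conj (x , y) = identity x y
  where
  identity : ∀ x y → (x + y) * (x + y) + (x + y) * - y + - y * - y ≡ x * x + x * y + y * y
  identity = solve-∀

norm-• : ∀ c z → norm (c • z) ≡ c * c * norm z
norm-• c (x , y) = identity c x y
  where
  identity : ∀ c x y → c * x * (c * x) + c * x * (c * y) + c * y * (c * y) ≡ c * c
    * (x * x + x * y + y * y)
  identity = solve-∀

conj-·-· : ∀ w z → conj w · (w · z) ≡ norm w • z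
conj-·-· (a , b) (x , y) = cong₂ _,_ (fst a b x y) (snd a b x y)
  where
  fst : ∀ a b x y → (a + b) * (a * x - b * y) - (- b) * (a * y + b * x + b * y)
    ≡ (a * a + a * b + b * b) * x
  fst = solve-∀
  snd : ∀ a b x y → (a + b) * (a * y + b * x + b * y) + - b * (a * x - b * y) + - b
    * (a * y + b * x + b * y)
    ≡ (a * a + a * b + b * b) * y
  snd = solve-∀

·-conj-· : ∀ w z → w · (conj w · z) ≡ norm w • z
·-conj-· (a , b) (x , y) = cong₂ _,_ (fst a b x y) (snd a b x y)
  where
  fst : ∀ a b x y → a * ((a + b) * x - (- b) * y) - b * ((a + b) * y + - b * x + - b * y)
    ≡ (a * a + a * b + b * b) * x
  fst = solve-∀
  snd : ∀ a b x y → a * ((a + b) * y + - b * x + - b * y) + b * ((a + b) * x - (- b) * y) + b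
    * ((a + b) * y + - b * x + - b * y)
    ≡ (a * a + a * b + b * b) * y
  snd = solve-∀

·-• : ∀ w c z → w · (c • z) ≡ c • (w · z)
·-• (a , b) c (x , y) = cong₂ _,_ (fst a b c x y) (snd a b c x y)
  where
  fst : ∀ a b c x y → a * (c * x) - b * (c * y) ≡ c * (a * x - b * y)
  fst = solve-∀
  snd : ∀ a b c x y → a * (c * y) + b * (c * x) + b * (c * y) ≡ c * (a * y + b * x + b * y)
  snd = solve-∀

·-⊕ : ∀ w u z → w · (u ⊕ z) ≡ w · u ⊕ w · z
·-⊕ (a , b) (u , v) (x , y) = cong₂ _,_ (fst a b u v x y) (snd a b u v x y)
  where
  fst : ∀ a b u v x y → a * (u + x) - b * (v + y) ≡ a * u - b * v + (a * x - b * y)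
  fst = solve-∀
  snd : ∀ a b u v x y → a * (v + y) + b * (u + x) + b * (v + y) ≡ a * v + b * u + b * v
    + (a * y + b * x + b * y)
  snd = solve-∀

trace : 𝔼 → ℤ
trace (a , b) = a + a + b

·-⊕-conj-· : ∀ w z → w · z ⊕ conj w · z ≡ trace w • z
·-⊕-conj-· (a , b) (x , y) = cong₂ _,_ (fst a b x y) (snd a b x y)
  where
  fst : ∀ a b x y → a * x - b * y + ((a + b) * x - (- b) * y) ≡ (a + a + b) * x
  fst = solve-∀
  snd : ∀ a b x y → a * y + b * x + b * y + ((a + b) * y + - b * x + - b * y) ≡ (a + a + b) * y
  snd = solve-∀

•-cancel : ∀ c .{{_ : ℤ.NonZero c}} {u v} → c • u ≡ c • v → u ≡ v
•-cancel c eq = cong₂ _,_ (ℤ.*-cancelˡ-≡ c _ _ (cong proj₁ eq)) (ℤ.*-cancelˡ-≡ c _ _ (cong proj₂ eq))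

∣²⇒• : ∀ {c} z → c ∣² z → ∃ λ u → z ≡ c • u
∣²⇒• {c} z (divides x eq , divides y eq′) =
  (x , y) , cong₂ _,_ (trans eq (ℤ.*-comm x c)) (trans eq′ (ℤ.*-comm y c))

∣-*ˡ : ∀ c x → c ∣ c * x
∣-*ˡ c x = divides x (ℤ.*-comm c x)

∣²-• : ∀ c z → c ∣² c • z
∣²-• c (x , y) = ∣-*ˡ c x , ∣-*ˡ c y

square≡∣∣ : ∀ i → i * i ≡ + (∣ i ∣ ℕ.* ∣ i ∣)
square≡∣∣ (+ n)    = sym (ℤ.pos-* n n)
square≡∣∣ -[1+ n ] = refl

-- Completing the square, 4(x² + xy + y²) = (2x + y)² + 3y². This gives at once that the norm is a
-- natural number and that it bounds the second coordinate.
norm-bound : ∀ z → ∃ λ n → norm z ≡ + n × 3 ℕ.* (∣ proj₂ z ∣ ℕ.* ∣ proj₂ z ∣) ≤ 4 ℕ.* n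
norm-bound (x , y) = go _ refl
  where
  s t : ℕ
  s = ∣ x + x + y ∣ ℕ.* ∣ x + x + y ∣
  t = ∣ y ∣ ℕ.* ∣ y ∣
  identity : ∀ x y → + 4 * (x * x + x * y + y * y) ≡ (x + x + y) * (x + x + y) + + 3 * (y * y)
  identity = solve-∀
  complete : + 4 * norm (x , y) ≡ + (s ℕ.+ 3 ℕ.* t)
  complete = begin
    + 4 * norm (x , y)                         ≡⟨ identity x y ⟩
    (x + x + y) * (x + x + y) + + 3 * (y * y)  ≡⟨
      cong₂ (λ a b → a + + 3 * b) (square≡∣∣ (x + x + y)) (square≡∣∣ y) ⟩
    + s + + 3 * + t                            ≡⟨ cong (_+_ (+ s)) (sym (ℤ.pos-* 3 t)) ⟩
    + s + + (3 ℕ.* t)                          ≡⟨ sym (ℤ.pos-+ s _) ⟩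
    + (s ℕ.+ 3 ℕ.* t)                          ∎
  go : ∀ k → norm (x , y) ≡ k → ∃ λ n → k ≡ + n × 3 ℕ.* t ≤ 4 ℕ.* n
  go (+ n) eq = n , refl , subst (3 ℕ.* t ≤_)
    (ℤ.+-injective (trans (sym complete) (trans (cong (_*_ (+ 4)) eq) (sym (ℤ.pos-* 4 n)))))
    (ℕ.m≤n+m _ s)
  go -[1+ n ] eq with () ← trans (sym complete) (cong (_*_ (+ 4)) eq)

norm-bound₂ : ∀ {z n} → norm z ≡ + n → 3 ℕ.* (∣ proj₂ z ∣ ℕ.* ∣ proj₂ z ∣) ≤ 4 ℕ.* n
norm-bound₂ {z} eq with norm-bound z
... | _ , eq′ , le with refl ← ℤ.+-injective (trans (sym eq) eq′) = le

norm-swap : ∀ x y → norm (y , x) ≡ norm (x , y)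
norm-swap = identity
  where
  identity : ∀ x y → y * y + y * x + x * x ≡ x * x + x * y + y * y
  identity = solve-∀

norm-bound₁ : ∀ {z n} → norm z ≡ + n → 3 ℕ.* (∣ proj₁ z ∣ ℕ.* ∣ proj₁ z ∣) ≤ 4 ℕ.* n
norm-bound₁ {x , y} eq = norm-bound₂ {y , x} (trans (norm-swap x y) eq)

norm≡0⇒≡0 : ∀ z → norm z ≡ 0ℤ → z ≡ (0ℤ , 0ℤ)
norm≡0⇒≡0 z eq = cong₂ _,_ (zero-abs _ (norm-bound₁ {z} eq)) (zero-abs _ (norm-bound₂ {z} eq))
  where
  zero-abs : ∀ i → 3 ℕ.* (∣ i ∣ ℕ.* ∣ i ∣) ≤ 0 → i ≡ 0ℤ
  zero-abs (+ zero) _ = refl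
  zero-abs (+ suc n) ()
  zero-abs -[1+ n ] ()

Rep : ℕ → Set
Rep j = Σ 𝔼 λ z → norm z ≡ + j

Rep-≡ : ∀ {j} {r s : Rep j} → proj₁ r ≡ proj₁ s → r ≡ s
Rep-≡ {r = _ , p} {_ , q} refl = cong (_ ,_) (Decidable⇒UIP.≡-irrelevant ℤ._≟_ p q)

-- Division by an element of given norm

module Division (w : 𝔼) (q : ℕ) .{{_ : NonZero q}} (norm-w : norm w ≡ + q) where

  conj-·-multiple : ∀ u → conj w · (w · u) ≡ + q • u
  conj-·-multiple u = trans (conj-·-· w u) (cong (_• u) norm-w)

  ·-cancel : ∀ {u v} → w · u ≡ w · v → u ≡ v
  ·-cancel {u} {v} eq = •-cancel (+ q)
    (trans (sym (conj-·-multiple u)) (trans (cong (conj w ·_) eq) (conj-·-multiple v)))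

  conj-·≡•⇒∣ : ∀ {u z} → conj w · z ≡ + q • u → w · u ≡ z
  conj-·≡•⇒∣ {u} {z} eq = •-cancel (+ q) (begin
    + q • (w · u)       ≡⟨ sym (·-• w (+ q) u) ⟩
    w · (+ q • u)       ≡⟨ cong (w ·_) (sym eq) ⟩
    w · (conj w · z)    ≡⟨ ·-conj-· w z ⟩
    norm w • z          ≡⟨ cong (_• z) norm-w ⟩
    + q • z             ∎)

  -- The quotient of z by w is (conj w · z) / q. Divisibility by w is therefore coordinatewise
  -- divisibility by the integer q, which is decidable.
  ∣²⇒∣ᴱ : ∀ {z} → + q ∣² conj w · z → w ∣ᴱ z
  ∣²⇒∣ᴱ {z} d = let u , eq = ∣²⇒• (conj w · z) d in u , conj-·≡•⇒∣ eq

  infix 4 ∣ᴱ?_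

  ∣ᴱ?_ : ∀ z → Dec (w ∣ᴱ z)
  ∣ᴱ? z = map′ ∣²⇒∣ᴱ (λ { (u , refl) → subst (+ q ∣²_) (sym (conj-·-multiple u)) (∣²-• (+ q) u) })
    ((+ q ∣? proj₁ (conj w · z)) ×-dec (+ q ∣? proj₂ (conj w · z)))

  norm-multiple : ∀ {u} j → norm u ≡ + j → norm (w · u) ≡ + (q ℕ.* j)
  norm-multiple {u} j eq = trans (norm-· w u) (trans (cong₂ _*_ norm-w eq) (sym (ℤ.pos-* q j)))

  norm-quotient : ∀ {u} j → norm (w · u) ≡ + (q ℕ.* j) → norm u ≡ + j
  norm-quotient {u} j eq = ℤ.*-cancelˡ-≡ (+ q) _ _ (begin
    + q * norm u      ≡⟨ cong (_* norm u) (sym norm-w) ⟩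
    norm w * norm u   ≡⟨ sym (norm-· w u) ⟩
    norm (w · u)      ≡⟨ eq ⟩
    + (q ℕ.* j)       ≡⟨ ℤ.pos-* q j ⟩
    + q * + j         ∎)

  divisible? : ∀ {j} (r : Rep j) → Dec (w ∣ᴱ proj₁ r)
  divisible? r = ∣ᴱ? proj₁ r

  -- The bijection is multiplication by w, which is injective and multiplies norms by q. What
  -- remains to be counted in `Rep (q ℕ.* j)` are the elements not divisible by w.
  multiples : ∀ j → Rep j ↔ Sat (divisible? {q ℕ.* j})
  multiples j = mk↔ₛ′ to from to∘from (λ u → Rep-≡ (·-cancel (from-spec (to u))))
    where
    to : Rep j → Sat (divisible? {q ℕ.* j})
    to (u , eq) = (w · u , norm-multiple j eq) , fromWitness (u , refl)
    quotient′ : (s : Sat (divisible? {q ℕ.* j})) → w ∣ᴱ proj₁ (proj₁ s)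
    quotient′ (r , d) = toWitness {a? = divisible? r} d
    from : Sat (divisible? {q ℕ.* j}) → Rep j
    from s = proj₁ (quotient′ s) ,
      norm-quotient j (trans (cong norm (proj₂ (quotient′ s))) (proj₂ (proj₁ s)))
    from-spec : ∀ s → w · proj₁ (from s) ≡ proj₁ (proj₁ s)
    from-spec s = proj₂ (quotient′ s)
    to∘from : ∀ s → to (from s) ≡ s
    to∘from s = Σ-True-≡ divisible? (Rep-≡ (from-spec s))

  card-multiples : ∀ {j a b} → HasCard (Rep j) a → HasCard (Unsat (divisible? {q ℕ.* j})) b →
    HasCard (Rep (q ℕ.* j)) (a + b)
  card-multiples {j} hj hu = card-↔ (↔-sym (↔-split divisible?)) (card-⊎ (card-↔ (multiples j) hj) hu)

  card-nonmultiples : ∀ {j a b} → HasCard (Rep (q ℕ.* j)) a → HasCard (Rep j) b →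
    HasCard (Unsat (divisible? {q ℕ.* j})) (a - b)
  card-nonmultiples {j} h hj = card-∸ (card-↔ (↔-split divisible?) h) (card-↔ (multiples j) hj)

  ∣⇒norm : ∀ {z j} → w ∣ᴱ z → norm z ≡ + j → q ℕ.∣ j
  ∣⇒norm {j = j} (u , refl) eq = ∣⇒∣ᵤ {+ q} {+ j}
    (subst (+ q ∣_) (trans (cong (_* norm u) (sym norm-w)) (trans (sym (norm-· w u)) eq))
      (∣-*ˡ (+ q) (norm u)))

-- Splitting of primes

euclid : ∀ {p} → Prime p → ∀ i j → + p ∣ i * j → (+ p ∣ i) ⊎ (+ p ∣ j)
euclid {p} pr i j d with euclidsLemma ∣ i ∣ ∣ j ∣ pr (subst (p ℕ.∣_) (ℤ.abs-* i j) (∣⇒∣ᵤ d))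
... | inj₁ e = inj₁ (∣ᵤ⇒∣ e)
... | inj₂ e = inj₂ (∣ᵤ⇒∣ e)

-- Cancelling p leaves p ∣ 1. This rules out that an element of norm p is a multiple of p.
p²∤p : ∀ {p} → Prime p → ∀ k → ¬ (+ p * + p * k ≡ + p)
p²∤p {p} pr k eq = ¬prime[1] (subst Prime (ℕ.∣1⇒≡1 (∣⇒∣ᵤ {+ p} {1ℤ} (divides k
  (ℤ.*-cancelˡ-≡ (+ p) 1ℤ (k * + p) (begin
    + p * 1ℤ        ≡⟨ ℤ.*-identityʳ (+ p) ⟩
    + p             ≡⟨ sym eq ⟩
    + p * + p * k   ≡⟨ rearrange (+ p) k ⟩
    + p * (k * + p) ∎))))) pr)
  where
  instance _ = prime⇒nonZero pr
  rearrange : ∀ p k → p * p * k ≡ p * (k * p)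
  rearrange = solve-∀

module Split {p} (pr : Prime p) (w : 𝔼) (norm-w : norm w ≡ + p) where
  private instance
    p≢0 : NonZero p
    p≢0 = prime⇒nonZero pr

  module W = Division w p norm-w
  module W̄ = Division (conj w) p (trans (norm-conj w) norm-w)

  conj-conj-· : ∀ z → conj (conj w) · z ≡ w · z
  conj-conj-· z = cong (_· z) (cong₂ _,_ (fst (proj₁ w) (proj₂ w)) (ℤ.neg-involutive (proj₂ w)))
    where
    fst : ∀ a b → a + b + - b ≡ a
    fst = solve-∀

  -- If p divides y, the norm is congruent to x² modulo p.
  ∣²-from-snd : ∀ z → + p ∣ norm z → + p ∣ proj₂ z → + p ∣² z
  ∣²-from-snd (x , y) d e = [ id , id ]′ (euclid pr x x
      (subst (+ p ∣_) (identity x y) (∣m∣n⇒∣m-n d (∣m⇒∣m*n (x + y) e)))) , e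
    where
    identity : ∀ x y → x * x + x * y + y * y - y * (x + y) ≡ x * x
    identity = solve-∀

  -- With w = (a , b) and z = (x , y), the second coordinates of conj w · z and w · z have product
  -- y² N(w) - b² N(z), a multiple of p. So p divides one of them and then, as both elements have
  -- norm divisible by p, the other coordinate of the same element.
  prime-∣norm : ∀ {z} → + p ∣ norm z → (w ∣ᴱ z) ⊎ (conj w ∣ᴱ z)
  prime-∣norm {z} d = Sum.map
      (λ e → W.∣²⇒∣ᴱ (∣²-from-snd (conj w · z) (∣norm-· (conj w)) e))
      (λ e → W̄.∣²⇒∣ᴱ (subst (+ p ∣²_) (sym (conj-conj-· z)) (∣²-from-snd (w · z) (∣norm-· w) e)))
      (euclid pr (proj₂ (conj w · z)) (proj₂ (w · z)) (subst (+ p ∣_)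
        (sym (identity (proj₁ w) (proj₂ w) (proj₁ z) (proj₂ z)))
        (∣m∣n⇒∣m-n (∣n⇒∣m*n (proj₂ z * proj₂ z) (∣-reflexive (sym norm-w)))
          (∣n⇒∣m*n (proj₂ w * proj₂ w) d))))
    where
    ∣norm-· : ∀ v → + p ∣ norm (v · z)
    ∣norm-· v = subst (+ p ∣_) (sym (norm-· v z)) (∣n⇒∣m*n (norm v) d)
    identity : ∀ a b x y → ((a + b) * y + - b * x + - b * y) * (a * y + b * x + b * y) ≡
      y * y * (a * a + a * b + b * b) - b * b * (x * x + x * y + y * y)
    identity = solve-∀

  -- Four times the norm minus the squared trace is 3b². If p divided the trace, it would divide b,
  -- hence w, and p² would divide N(w) = p.
  p∤trace : ¬ p ≡ 3 → ¬ + p ∣ trace w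
  p∤trace p≢3 d = [ p∤3 , (λ e → [ p∤b , p∤b ]′ (euclid pr b b e)) ]′ (euclid pr (+ 3) (b * b)
      (subst (+ p ∣_) (identity a b) (∣m∣n⇒∣m-n (∣n⇒∣m*n (+ 4) (∣-reflexive (sym norm-w)))
        (∣m⇒∣m*n (trace w) d))))
    where
    a = proj₁ w
    b = proj₂ w
    identity : ∀ a b → + 4 * (a * a + a * b + b * b) - (a + a + b) * (a + a + b) ≡ + 3 * (b * b)
    identity = solve-∀
    p∤3 : ¬ + p ∣ + 3
    p∤3 e with prime⇒irreducible (toWitness {a? = prime? 3} _) (∣⇒∣ᵤ e)
    ... | inj₁ refl = ¬prime[1] pr
    ... | inj₂ eq   = p≢3 eq
    p∤b : ¬ + p ∣ b
    p∤b e = let u , w≡ = ∣²⇒• w (∣²-from-snd w (∣-reflexive (sym norm-w)) e) in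
      p²∤p pr (norm u) (trans (sym (norm-• (+ p) u)) (trans (cong norm (sym w≡)) norm-w))

  -- w and conj w have no common factor, since their sum, the trace, is prime to p.
  ∣conj-·⇒∣ : ¬ p ≡ 3 → ∀ {z} → w ∣ᴱ conj w · z → w ∣ᴱ z
  ∣conj-·⇒∣ p≢3 {z} (u , eq) = W.∣²⇒∣ᴱ
    (coordinate proj₁ (λ _ _ → refl) (∣²-• (+ p) (z ⊕ u) .proj₁)
    , coordinate proj₂ (λ _ _ → refl) (∣²-• (+ p) (z ⊕ u) .proj₂))
    where
    t = trace w
    -- Since w · u = conj w · z, the sum w · z + w · u is (w + conj w) · z, a trace multiple of z.
    -- Thus p divides t • (conj w · z), and t can be cancelled modulo p.
    p∣t• : + p • (z ⊕ u) ≡ t • (conj w · z)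
    p∣t• = begin
      + p • (z ⊕ u)                  ≡⟨ cong (_• (z ⊕ u)) (sym norm-w) ⟩
      norm w • (z ⊕ u)               ≡⟨ sym (conj-·-· w (z ⊕ u)) ⟩
      conj w · (w · (z ⊕ u))         ≡⟨ cong (conj w ·_) (·-⊕ w z u) ⟩
      conj w · (w · z ⊕ w · u)       ≡⟨ cong (λ v → conj w · (w · z ⊕ v)) eq ⟩
      conj w · (w · z ⊕ conj w · z)  ≡⟨ cong (conj w ·_) (·-⊕-conj-· w z) ⟩
      conj w · (t • z)               ≡⟨ ·-• (conj w) t z ⟩
      t • (conj w · z)               ∎
    coordinate : (π : 𝔼 → ℤ) → (∀ c v → π (c • v) ≡ c * π v) → + p ∣ π (+ p • (z ⊕ u)) →
      + p ∣ π (conj w · z)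
    coordinate π π-• d = [ (λ e → contradiction e (p∤trace p≢3)) , id ]′
      (euclid pr t (π (conj w · z)) (subst (+ p ∣_) (trans (cong π p∣t•) (π-• t (conj w · z))) d))

  -- The bijection is multiplication by conj w. It preserves non-divisibility by w because the two
  -- factors are coprime; it is onto because an element of norm pj not divisible by w is divisible
  -- by conj w.
  nonmultiples : ¬ p ≡ 3 → ∀ j → Unsat (W.divisible? {j}) ↔ Unsat (W.divisible? {p ℕ.* j})
  nonmultiples p≢3 j = mk↔ₛ′ to from to∘from
    (λ s → Σ-False-≡ W.divisible? (Rep-≡ (W̄.·-cancel (from-spec (to s)))))
    where
    to : Unsat (W.divisible? {j}) → Unsat (W.divisible? {p ℕ.* j})
    to ((u , eq) , f) = (conj w · u , W̄.norm-multiple j eq) ,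
      fromWitnessFalse (λ d → toWitnessFalse {a? = W.∣ᴱ? u} f (∣conj-·⇒∣ p≢3 d))
    quotient′ : (s : Unsat (W.divisible? {p ℕ.* j})) → conj w ∣ᴱ proj₁ (proj₁ s)
    quotient′ ((z , eq) , f) = [ (λ d → contradiction d (toWitnessFalse {a? = W.∣ᴱ? z} f)) , id ]′
      (prime-∣norm {z} (subst (+ p ∣_) (sym (trans eq (ℤ.pos-* p j))) (∣-*ˡ (+ p) (+ j))))
    -- If the quotient by conj w were w · v, then z = conj w · (w · v) = w · (conj w · v) would be a
    -- multiple of w.
    w∤quotient : ∀ s → ¬ w ∣ᴱ proj₁ (quotient′ s)
    w∤quotient s@((z , _) , f) (v , eq) = toWitnessFalse {a? = W.∣ᴱ? z} f (conj w · v , (begin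
      w · (conj w · v)       ≡⟨ ·-conj-· w v ⟩
      norm w • v             ≡⟨ sym (conj-·-· w v) ⟩
      conj w · (w · v)       ≡⟨ cong (conj w ·_) eq ⟩
      conj w · proj₁ (quotient′ s) ≡⟨ proj₂ (quotient′ s) ⟩
      z                      ∎))
    from : Unsat (W.divisible? {p ℕ.* j}) → Unsat (W.divisible? {j})
    from s = (proj₁ (quotient′ s) , W̄.norm-quotient j
      (trans (cong norm (proj₂ (quotient′ s))) (proj₂ (proj₁ s)))) ,
      fromWitnessFalse (w∤quotient s)
    from-spec : ∀ s → conj w · proj₁ (proj₁ (from s)) ≡ proj₁ (proj₁ s)
    from-spec s = proj₂ (quotient′ s)
    to∘from : ∀ s → to (from s) ≡ s
    to∘from s = Σ-False-≡ W.divisible? (Rep-≡ (from-spec s))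

  -- Multiples of w of norm p²k correspond to `Rep (p ℕ.* k)`. Non-multiples correspond to those of
  -- norm pk, which number a - b because the multiples of w of norm pk correspond to `Rep k`.
  card-split-∣ : ¬ p ≡ 3 → ∀ {k a b} → HasCard (Rep (p ℕ.* k)) a → HasCard (Rep k) b →
                 HasCard (Rep (p ℕ.* (p ℕ.* k))) (a + (a - b))
  card-split-∣ p≢3 {k} ha hb = W.card-multiples ha
    (card-↔ (nonmultiples p≢3 (p ℕ.* k)) (W.card-nonmultiples ha hb))

  -- As p does not divide j, no element of norm j is divisible by w, so multiples and non-multiples
  -- of norm pj each number a.
  card-split-∤ : ¬ p ≡ 3 → ∀ {j a} → ¬ p ℕ.∣ j → HasCard (Rep j) a → HasCard (Rep (p ℕ.* j)) (a + a)
  card-split-∤ p≢3 {j} p∤j ha = W.card-multiples ha (card-↔ (nonmultiples p≢3 j)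
    (subst (HasCard _) (ℤ.+-identityʳ _) (card-∸ (card-↔ (↔-split W.divisible?) ha)
      (card-⊥ λ { (r , d) → p∤j (W.∣⇒norm (toWitness {a? = W.divisible? r} d) (proj₂ r)) }))))

-- The element w = 1 + ζ has norm 3 and is associate to its conjugate: 2 - ζ = (1 + ζ)(1 - ζ), where
-- 1 - ζ is a unit. So w divides every element of norm 3j, and division by w is a bijection onto
-- `Rep j`.
card-ramified : ∀ {j a} → HasCard (Rep j) a → HasCard (Rep (3 ℕ.* j)) a
card-ramified {j} ha = subst (HasCard _) (ℤ.+-identityʳ _) (card-multiples ha
    (card-⊥ λ { (r@(z , eq) , f) → toWitnessFalse {a? = divisible? r} f
      (divisible z (subst (+ 3 ∣_) (sym (trans eq (ℤ.pos-* 3 j))) (∣-*ˡ (+ 3) (+ j)))) }))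
  where
  3-prime : Prime 3
  3-prime = toWitness {a? = prime? 3} _
  w : 𝔼
  w = 1ℤ , 1ℤ
  open Division w 3 refl
  open Split 3-prime w refl
  conj-w : ∀ u → (+ 2 , - 1ℤ) · u ≡ (1ℤ , 1ℤ) · ((1ℤ , - 1ℤ) · u)
  conj-w (x , y) = cong₂ _,_ (fst x y) (snd x y)
    where
    fst : ∀ x y → + 2 * x - - 1ℤ * y ≡ 1ℤ * (1ℤ * x - - 1ℤ * y) - 1ℤ * (1ℤ * y + - 1ℤ * x + - 1ℤ * y)
    fst = solve-∀
    snd : ∀ x y → + 2 * y + - 1ℤ * x + - 1ℤ * y ≡ 1ℤ * (1ℤ * y + - 1ℤ * x + - 1ℤ * y) + 1ℤ
      * (1ℤ * x - - 1ℤ * y) + 1ℤ * (1ℤ * y + - 1ℤ * x + - 1ℤ * y)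
    snd = solve-∀
  divisible : ∀ z → + 3 ∣ norm z → w ∣ᴱ z
  divisible z d = [ id , (λ (u , eq) → (1ℤ , - 1ℤ) · u , trans (sym (conj-w u)) eq) ]′
    (prime-∣norm {z} d)

module Inert {p} (pr : Prime p) (inert : ∀ z → + p ∣ norm z → + p ∣² z) where
  private instance
    p≢0 : NonZero p
    p≢0 = prime⇒nonZero pr
    p²≢0 : NonZero (p ℕ.* p)
    p²≢0 = ℕ.m*n≢0 p p

  -- Divisibility of the norm by p already makes the element a multiple of p, so its norm is
  -- divisible by p². Hence no norm is pj with p prime to j, and division by p matches norms p²k
  -- with norms k.
  multiple : ∀ {j} (r : Rep (p ℕ.* j)) → ∃ λ u → proj₁ r ≡ + p • u
  multiple {j} (z , eq) = ∣²⇒• z (inert z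
    (subst (+ p ∣_) (sym (trans eq (ℤ.pos-* p j))) (∣-*ˡ (+ p) (+ j))))

  card-inert-∤ : ∀ {j} → ¬ p ℕ.∣ j → HasCard (Rep (p ℕ.* j)) 0ℤ
  card-inert-∤ {j} p∤j = card-⊥ λ r → let u , eq = multiple r in
    p∤j (∣⇒∣ᵤ {+ p} {+ j} (divides (norm u) (ℤ.*-cancelˡ-≡ (+ p) _ _ (begin
      + p * + j             ≡⟨ sym (ℤ.pos-* p j) ⟩
      + (p ℕ.* j)           ≡⟨ sym (proj₂ r) ⟩
      norm (proj₁ r)        ≡⟨ cong norm eq ⟩
      norm (+ p • u)        ≡⟨ norm-• (+ p) u ⟩
      + p * + p * norm u    ≡⟨ rearrange (+ p) (norm u) ⟩
      + p * (norm u * + p)  ∎))))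
    where
    rearrange : ∀ p k → p * p * k ≡ p * (k * p)
    rearrange = solve-∀

  card-inert-∣ : ∀ {k a} → HasCard (Rep k) a → HasCard (Rep (p ℕ.* (p ℕ.* k))) a
  card-inert-∣ {k} ha = subst₂ HasCard (cong Rep (ℕ.*-assoc p p k)) (ℤ.+-identityʳ _) (card-multiples ha
      (card-⊥ λ { (r , f) → toWitnessFalse {a? = divisible? r} f (divisible r) }))
    where
    w : 𝔼
    w = + p , 0ℤ
    norm-w : norm w ≡ + (p ℕ.* p)
    norm-w = trans (identity (+ p)) (sym (ℤ.pos-* p p))
      where
      identity : ∀ p → p * p + p * 0ℤ + 0ℤ * 0ℤ ≡ p * p
      identity = solve-∀
    open Division w (p ℕ.* p) norm-w
    scalar : ∀ u → w · u ≡ + p • u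
    scalar (x , y) = cong₂ _,_ (fst (+ p) x y) (snd (+ p) x y)
      where
      fst : ∀ p x y → p * x - 0ℤ * y ≡ p * x
      fst = solve-∀
      snd : ∀ p x y → p * y + 0ℤ * x + 0ℤ * y ≡ p * y
      snd = solve-∀
    divisible : (r : Rep (p ℕ.* p ℕ.* k)) → w ∣ᴱ proj₁ r
    divisible (z , eq) = let u , z≡ = multiple (z , trans eq (cong +_ (ℕ.*-assoc p p k))) in
      u , trans (scalar u) (sym z≡)

-- Descent

-- For coordinates of opposite sign the norm is a² - ab + b², which is at most the larger of a² and
-- b². With equal signs it could exceed m².
residue-norm-bound : ∀ {a b m n} → a < m → b < m → norm (+ a , - + b) ≡ + n → n < m ℕ.* m
residue-norm-bound {a} {b} {m} {n} a<m b<m eq = [ case₁ , case₂ ]′ (ℕ.≤-total a b)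
  where
  identity : ∀ a b → a * a + b * b ≡ a * b + (a * a + a * - b + - b * - b)
  identity = solve-∀
  cross-term : a ℕ.* a ℕ.+ b ℕ.* b ≡ a ℕ.* b ℕ.+ n
  cross-term = ℤ.+-injective (begin
    + (a ℕ.* a ℕ.+ b ℕ.* b)          ≡⟨ ℤ.pos-+ (a ℕ.* a) (b ℕ.* b) ⟩
    + (a ℕ.* a) + + (b ℕ.* b)        ≡⟨ cong₂ _+_ (ℤ.pos-* a a) (ℤ.pos-* b b) ⟩
    + a * + a + + b * + b            ≡⟨ identity (+ a) (+ b) ⟩
    + a * + b + norm (+ a , - + b)   ≡⟨ cong₂ _+_ (sym (ℤ.pos-* a b)) eq ⟩
    + (a ℕ.* b) + + n                ≡⟨ sym (ℤ.pos-+ (a ℕ.* b) n) ⟩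
    + (a ℕ.* b ℕ.+ n)                ∎)
  bound : ∀ {x y z} → x ≤ y → x ℕ.+ z ≡ y ℕ.+ n → n ≤ z
  bound {x} {y} {z} x≤y e = ℕ.+-cancelˡ-≤ y n z (subst (_≤ y ℕ.+ z) e (ℕ.+-monoˡ-≤ z x≤y))
  case₁ : a ≤ b → n < m ℕ.* m
  case₁ a≤b = ℕ.≤-<-trans (bound (ℕ.*-monoʳ-≤ a a≤b) cross-term) (ℕ.*-mono-< b<m b<m)
  case₂ : b ≤ a → n < m ℕ.* m
  case₂ b≤a = ℕ.≤-<-trans
    (bound (ℕ.*-monoˡ-≤ b b≤a) (trans (ℕ.+-comm (b ℕ.* b) (a ℕ.* a)) cross-term)) (ℕ.*-mono-< a<m a<m)

norm-⊕-• : ∀ r m q → ∃ λ t → norm (r ⊕ m • q) ≡ norm r + m * t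
norm-⊕-• (a , b) m (x , y) =
  (+ 2 * a * x + a * y + b * x + + 2 * b * y + m * (x * x + x * y + y * y)) , identity a b m x y
  where
  identity : ∀ a b m x y → (a + m * x) * (a + m * x) + (a + m * x) * (b + m * y) + (b + m * y)
    * (b + m * y) ≡
    a * a + a * b + b * b + m * (+ 2 * a * x + a * y + b * x + + 2 * b * y + m
      * (x * x + x * y + y * y))
  identity = solve-∀

reduce : ∀ m .{{_ : NonZero m}} z → + m ∣ norm z →
         ∃ λ r → ∃ λ q → ∃ λ m′ → z ≡ r ⊕ + m • q × norm r ≡ + m * + m′ × m′ < m
reduce m (x , y) d = r , q , m′ , z≡ , norm-r , m′<m
  where
  a b : ℕ
  a = x %ℕ m
  -- The remainder of - y is taken, so that the residue `r` has first coordinate in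
  -- [0, m) and second in (-m, 0], as the bound on the norm requires.
  b = (- y) %ℕ m
  r q : 𝔼
  r = + a , - + b
  q = x /ℕ m , - ((- y) /ℕ m)
  z≡ : (x , y) ≡ r ⊕ + m • q
  z≡ = cong₂ _,_ (trans (a≡a%ℕn+[a/ℕn]*n x m) (cong (_+_ (+ a)) (ℤ.*-comm (x /ℕ m) (+ m))))
    (trans (sym (ℤ.neg-involutive y)) (trans (cong -_ (a≡a%ℕn+[a/ℕn]*n (- y) m))
      (negate (+ b) ((- y) /ℕ m) (+ m))))
    where
    negate : ∀ b k m → - (b + k * m) ≡ - b + m * - k
    negate = solve-∀
  n : ℕ
  n = proj₁ (norm-bound r)
  norm-r≡n : norm r ≡ + n
  norm-r≡n = proj₁ (proj₂ (norm-bound r))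
  m∣n : m ℕ.∣ n
  m∣n = ∣⇒∣ᵤ {+ m} {+ n} (subst (+ m ∣_) norm-r≡n (∣m+n∣n⇒∣m
    (subst (+ m ∣_) (trans (cong norm z≡) (proj₂ (norm-⊕-• r (+ m) q))) d)
    (∣-*ˡ (+ m) (proj₁ (norm-⊕-• r (+ m) q)))))
  m′ : ℕ
  m′ = ℕ.quotient m∣n
  n≡ : n ≡ m′ ℕ.* m
  n≡ = ℕ._∣_.equality m∣n
  norm-r : norm r ≡ + m * + m′
  norm-r = trans norm-r≡n (trans (cong +_ (trans n≡ (ℕ.*-comm m′ m))) (ℤ.pos-* m m′))
  m′<m : m′ < m
  m′<m = ℕ.*-cancelʳ-< m m′ m (subst (_< m ℕ.* m) n≡
    (residue-norm-bound (n%ℕd<d x m) (n%ℕd<d (- y) m) norm-r≡n))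

⊕-identityˡ : ∀ z → (0ℤ , 0ℤ) ⊕ z ≡ z
⊕-identityˡ (x , y) = cong₂ _,_ (ℤ.+-identityˡ x) (ℤ.+-identityˡ y)

norm-residue≡0 : ∀ {m z r q m′} → z ≡ r ⊕ + m • q → norm r ≡ + m * + m′ → m′ ≡ 0 → z ≡ + m • q
norm-residue≡0 {m} {r = r} {q} z≡ nr refl = trans z≡ (trans
  (cong (_⊕ + m • q) (norm≡0⇒≡0 r (trans nr (ℤ.*-zeroʳ (+ m))))) (⊕-identityˡ _))

-- Since z = r + mq, the product conj r · z is N(r) + m (conj r · q), and N(r) = m m′.
conj-residue : ∀ {m m′ z r q} → z ≡ r ⊕ m • q → norm r ≡ m * m′ → ∃ λ u → conj r · z ≡ m • u
conj-residue {m} {m′} {r = r} {q} refl nr = (m′ , 0ℤ) ⊕ conj r · q , cong₂ _,_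
    (trans (fst (proj₁ r) (proj₂ r) m (proj₁ q) (proj₂ q))
      (trans (cong (_+ m * proj₁ (conj r · q)) nr) (sym (ℤ.*-distribˡ-+ m m′ (proj₁ (conj r · q))))))
    (snd (proj₁ r) (proj₂ r) m (proj₁ q) (proj₂ q))
  where
  fst : ∀ a b m x y → (a + b) * (a + m * x) - - b * (b + m * y) ≡ a * a + a * b + b * b + m
    * ((a + b) * x - - b * y)
  fst = solve-∀
  snd : ∀ a b m x y → (a + b) * (b + m * y) + - b * (a + m * x) + - b * (b + m * y) ≡ m
    * (0ℤ + ((a + b) * y + - b * x + - b * y))
  snd = solve-∀

descent-norm : ∀ m .{{_ : NonZero m}} m′ p {z r u} → norm z ≡ + m * + p → norm r ≡ + m * + m′ →
               conj r · z ≡ + m • u → norm u ≡ + m′ * + p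
descent-norm m m′ p {z} {r} {u} nz nr eq = ℤ.*-cancelˡ-≡ (+ m) _ _ (ℤ.*-cancelˡ-≡ (+ m) _ _ (begin
  + m * (+ m * norm u)           ≡⟨ sym (ℤ.*-assoc (+ m) (+ m) (norm u)) ⟩
  + m * + m * norm u             ≡⟨ sym (norm-• (+ m) u) ⟩
  norm (+ m • u)                 ≡⟨ cong norm (sym eq) ⟩
  norm (conj r · z)              ≡⟨ norm-· (conj r) z ⟩
  norm (conj r) * norm z         ≡⟨ cong₂ _*_ (trans (norm-conj r) nr) nz ⟩
  + m * + m′ * (+ m * + p)       ≡⟨ rearrange (+ m) (+ m′) (+ p) ⟩
  + m * (+ m * (+ m′ * + p))     ∎))
  where
  rearrange : ∀ m m′ p → m * m′ * (m * p) ≡ m * (m * (m′ * p))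
  rearrange = solve-∀

-- One round of descent replaces z by u = (conj r · z) / m, where r is the residue of z modulo m.
-- Norms multiply, so N(u) = m′p with m′ < m.
descend : ∀ {p} → Prime p → ∀ {m} → Acc _<_ m → 0 < m → m < p → ∀ {z} → norm z ≡ + m * + p → ∃ λ w →
  norm w ≡ + p
descend pr {suc zero} _ _ _ {z} nz = z , trans nz (ℤ.*-identityˡ _)
descend {p} pr {m@(suc (suc _))} (acc rs) 0<m m<p {z} nz =
  step (reduce m z (subst (+ m ∣_) (sym nz) (∣-*ˡ (+ m) (+ p))))
  where
  m∤p : ¬ m ℕ.∣ p
  m∤p m∣p = [ (λ ()) , (λ m≡p → ℕ.<⇒≢ m<p m≡p) ]′ (prime⇒irreducible pr m∣p)
  step : (∃ λ r → ∃ λ q → ∃ λ m′ → z ≡ r ⊕ + m • q × norm r ≡ + m * + m′ × m′ < m) → ∃ λ w →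
    norm w ≡ + p
  -- A residue of norm zero vanishes, so m divides z, m² divides mp and m divides p. This is
  -- impossible for 1 < m < p.
  step (r , q , zero , z≡ , nr , _) =
    contradiction (∣⇒∣ᵤ {+ m} {+ p} (divides (norm q) (ℤ.*-cancelˡ-≡ (+ m) _ _ (begin
    + m * + p              ≡⟨ sym nz ⟩
    norm z                 ≡⟨ cong norm (norm-residue≡0 {m} {z} {r} {q} z≡ nr refl) ⟩
    norm (+ m • q)         ≡⟨ norm-• (+ m) q ⟩
    + m * + m * norm q     ≡⟨ trans (ℤ.*-assoc (+ m) (+ m) (norm q))
      (cong (_*_ (+ m)) (ℤ.*-comm (+ m) (norm q))) ⟩
    + m * (norm q * + m)   ∎)))) m∤p
  step (r , q , m′@(suc _) , z≡ , nr , m′<m) =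
    let u , eq = conj-residue {+ m} {+ m′} {z} {r} {q} z≡ nr in
    descend pr (rs m′<m) ℕ.z<s (ℕ.<-trans m′<m m<p) {u} (descent-norm m m′ p {z} {r} nz nr eq)

-- Reducing z modulo p itself gives norm pm′ with m′ < p, the starting point of the descent. Here m′
-- is positive because p does not divide z.
isotropic⇒norm : ∀ {p} → Prime p → ∀ {z} → + p ∣ norm z → ¬ + p ∣² z → ∃ λ w → norm w ≡ + p
isotropic⇒norm {p} pr {z} d p∤z = step (reduce p z d)
  where
  instance _ = prime⇒nonZero pr
  step : (∃ λ r → ∃ λ q → ∃ λ m′ → z ≡ r ⊕ + p • q × norm r ≡ + p * + m′ × m′ < p) → ∃ λ w →
    norm w ≡ + p
  step (r , q , zero , z≡ , nr , _) =
    contradiction (subst (+ p ∣²_) (sym (norm-residue≡0 {p} {z} {r} {q} z≡ nr refl)) (∣²-• (+ p) q)) p∤z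
  step (r , q , m′@(suc _) , z≡ , nr , m′<p) =
    descend pr (<-wellFounded m′) ℕ.z<s m′<p {r} (trans nr (ℤ.*-comm (+ p) (+ m′)))

-- The projective line over 𝔽ₚ

minimal : ℕ → ℕ → ℕ → ℕ
minimal a b c = if does (a ℕ.<? b) then (if does (a ℕ.<? c) then 1 else 0) else 0

minimal-one : ∀ {a b c} → a < b → a < c → minimal a b c ≡ 1
minimal-one {a} {b} {c} a<b a<c
  rewrite dec-true (a ℕ.<? b) a<b | dec-true (a ℕ.<? c) a<c = refl

minimal-zero₁ : ∀ {a b c} → b < a → minimal a b c ≡ 0
minimal-zero₁ {a} {b} b<a rewrite dec-false (a ℕ.<? b) (ℕ.<-asym b<a) = refl

minimal-zero₂ : ∀ {a b c} → c < a → minimal a b c ≡ 0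
minimal-zero₂ {a} {b} {c} c<a rewrite dec-false (a ℕ.<? c) (ℕ.<-asym c<a) with does (a ℕ.<? b)
... | true  = refl
... | false = refl

minimal-cyclic : ∀ {a b c} → a ≢ b → b ≢ c → c ≢ a →
  minimal a b c ℕ.+ (minimal b c a ℕ.+ minimal c a b) ≡ 1
minimal-cyclic {a} {b} {c} a≢b b≢c c≢a with ℕ.<-cmp a b | ℕ.<-cmp b c | ℕ.<-cmp c a
... | tri≈ _ a≡b _ | _ | _ = contradiction a≡b a≢b
... | _ | tri≈ _ b≡c _ | _ = contradiction b≡c b≢c
... | _ | _ | tri≈ _ c≡a _ = contradiction c≡a c≢a
... | tri< a<b _ _ | _ | tri> _ _ a<c
  rewrite minimal-one a<b a<c | minimal-zero₂ {b} {c} a<b | minimal-zero₁ {c} {a} {b} a<c = refl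
... | tri> _ _ b<a | tri< b<c _ _ | _
  rewrite minimal-one b<c b<a | minimal-zero₁ {a} {b} {c} b<a | minimal-zero₂ {c} {a} b<c = refl
... | _ | tri> _ _ c<b | tri< c<a _ _
  rewrite minimal-one c<a c<b | minimal-zero₂ {a} {b} c<a | minimal-zero₁ {b} {c} {a} c<b = refl
-- The last two clauses are the circular orders, excluded by transitivity.
... | tri< a<b _ _ | tri< b<c _ _ | tri< c<a _ _ = contradiction (ℕ.<-trans a<b b<c) (ℕ.<-asym c<a)
... | tri> _ _ b<a | tri> _ _ c<b | tri> _ _ a<c = contradiction (ℕ.<-trans c<b b<a) (ℕ.<-asym a<c)

sum-ones : ∀ n → sum {n} (λ _ → 1) ≡ n
sum-ones zero    = refl
sum-ones (suc n) = cong suc (sum-ones n)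

-- Every orbit of f has exactly one least element.
order-3-no-fixpoint⇒3∣ : ∀ {n} (f : Fin n → Fin n) → (∀ i → f (f (f i)) ≡ i) → (∀ i → f i ≢ i) → 3 ℕ.∣ n
order-3-no-fixpoint⇒3∣ {n} f f³ f≢ = ℕ.divides (sum m) (begin
  n                                                   ≡⟨ sum-ones n ⟨
  sum {n} (λ _ → 1)                                   ≡⟨ sum-cong-≗ one ⟨
  sum (λ i → m i ℕ.+ (m (f i) ℕ.+ m (f (f i))))       ≡⟨ ∑-distrib-+ m _ ⟩
  sum m ℕ.+ sum (λ i → m (f i) ℕ.+ m (f (f i)))       ≡⟨ cong (sum m ℕ.+_) (∑-distrib-+ (m ∘ f) _) ⟩
  sum m ℕ.+ (sum (m ∘ f) ℕ.+ sum (m ∘ f ∘ f))         ≡⟨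
    cong (sum m ℕ.+_) (cong₂ ℕ._+_ (shift m) (trans (shift (m ∘ f)) (shift m))) ⟩
  sum m ℕ.+ (sum m ℕ.+ sum m)                         ≡⟨
    cong (λ s → sum m ℕ.+ (sum m ℕ.+ s)) (sym (ℕ.+-identityʳ (sum m))) ⟩
  3 ℕ.* sum m                                         ≡⟨ ℕ.*-comm 3 (sum m) ⟩
  sum m ℕ.* 3                                         ∎)
  where
  m : Fin n → ℕ
  m i = minimal (toℕ i) (toℕ (f i)) (toℕ (f (f i)))
  -- As f is a permutation with inverse f ∘ f, re-indexing a sum by f does not change it.
  shift : ∀ (g : Fin n → ℕ) → sum (g ∘ f) ≡ sum g
  shift g = sym (sum-permute g (mk↔ₛ′ f (f ∘ f) f³ f³))
  one : ∀ i → m i ℕ.+ (m (f i) ℕ.+ m (f (f i))) ≡ 1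
  one i rewrite f³ i = minimal-cyclic (distinct i) (distinct (f i))
    (subst (λ k → toℕ (f (f i)) ≢ toℕ k) (f³ i) (distinct (f (f i))))
    where
    distinct : ∀ i → toℕ i ≢ toℕ (f i)
    distinct i eq = f≢ i (sym (toℕ-injective eq))

abs-unit : ∀ i → ∃ λ s → + ∣ i ∣ ≡ s * i
abs-unit (+ n)    = 1ℤ , sym (ℤ.*-identityˡ (+ n))
abs-unit -[1+ n ] = - 1ℤ , sym (ℤ.-1*i≡-i -[1+ n ])

-- Bézout coefficients for p and the absolute value of v provide the inverse, up to the sign `σ` of
-- v.
inverse-mod : ∀ {p} → Prime p → ∀ {v} → ¬ + p ∣ v → ∃ λ s → + p ∣ s * v - 1ℤ
inverse-mod {p} pr {v} p∤v = let σ , eq = abs-unit v ; t , d = inverse (coprime-Bézout coprime)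
  in t * σ , subst (λ a → + p ∣ a - 1ℤ) (trans (cong (t *_) eq) (sym (ℤ.*-assoc t σ v))) d
  where
  k = ∣ v ∣
  coprime : Coprime p k
  coprime (d∣p , d∣k) = [ id , (λ { refl → contradiction (∣ᵤ⇒∣ d∣k) p∤v }) ]′ (prime⇒irreducible pr d∣p)
  inverse : Bézout.Identity 1 p k → ∃ λ t → + p ∣ t * + k - 1ℤ
  inverse (Bézout.+- x y eq) = - + y , divides (- + x) (begin
    - + y * + k - 1ℤ        ≡⟨ negate (+ y) (+ k) ⟩
    - (1ℤ + + y * + k)      ≡⟨ cong (λ e → - (1ℤ + e)) (sym (ℤ.pos-* y k)) ⟩
    - + (1 ℕ.+ y ℕ.* k)     ≡⟨ cong (λ e → - + e) eq ⟩
    - + (x ℕ.* p)           ≡⟨ cong -_ (ℤ.pos-* x p) ⟩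
    - (+ x * + p)           ≡⟨ ℤ.neg-distribˡ-* (+ x) (+ p) ⟩
    - + x * + p             ∎)
    where
    negate : ∀ y k → - y * k - 1ℤ ≡ - (1ℤ + y * k)
    negate = solve-∀
  inverse (Bézout.-+ x y eq) = + y , divides (+ x) (begin
    + y * + k - 1ℤ          ≡⟨ cong (_- 1ℤ) (sym (ℤ.pos-* y k)) ⟩
    + (y ℕ.* k) - 1ℤ        ≡⟨ cong (λ e → + e - 1ℤ) (sym eq) ⟩
    + (1 ℕ.+ x ℕ.* p) - 1ℤ  ≡⟨ cong (_- 1ℤ) (ℤ.pos-+ 1 (x ℕ.* p)) ⟩
    1ℤ + + (x ℕ.* p) - 1ℤ   ≡⟨ drop (+ (x ℕ.* p)) ⟩
    + (x ℕ.* p)             ≡⟨ ℤ.pos-* x p ⟩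
    + x * + p               ∎)
    where
    drop : ∀ a → 1ℤ + a - 1ℤ ≡ a
    drop = solve-∀

-- This is the determinant of two vectors. For vectors that are non-zero modulo p, it vanishes
-- modulo p exactly when they span the same point of the projective line.
cross : 𝔼 → 𝔼 → ℤ
cross (a , b) (x , y) = a * y - b * x

ζ·_ : 𝔼 → 𝔼
ζ· (x , y) = - y , x + y

module ProjectiveLine {p} (pr : Prime p) where
  private instance
    p≢0 : NonZero p
    p≢0 = prime⇒nonZero pr

  infix 4 _∥_
  _∥_ : 𝔼 → 𝔼 → Set
  u ∥ v = + p ∣ cross u v

  -- The points of the projective line over 𝔽ₚ: ∞ first, then the p finite points.
  point : Fin (suc p) → 𝔼
  point Fin.zero    = 1ℤ , 0ℤ
  point (Fin.suc i) = + toℕ i , 1ℤ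

  p∤1 : ¬ + p ∣ 1ℤ
  p∤1 d = ¬prime[1] (subst Prime (ℕ.∣1⇒≡1 (∣⇒∣ᵤ {+ p} {1ℤ} d)) pr)

  point-nonzero : ∀ i → ¬ + p ∣² point i
  point-nonzero Fin.zero    (d , _) = p∤1 d
  point-nonzero (Fin.suc i) (_ , d) = p∤1 d

  ζ-nonzero : ∀ {z} → ¬ + p ∣² z → ¬ + p ∣² ζ· z
  ζ-nonzero {x , y} p∤z (d , e) = p∤z
    (subst (+ p ∣_) (x≡ x y) (∣m∣n⇒∣m+n e d) , subst (+ p ∣_) (ℤ.neg-involutive y) (∣m⇒∣-m d))
    where
    x≡ : ∀ x y → x + y + - y ≡ x
    x≡ = solve-∀

  normalise : ∀ {z} → ¬ + p ∣² z → ∃ λ i → point i ∥ z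
  normalise {u , v} p∤z with + p ∣? v
  ... | yes p∣v = Fin.zero , subst (+ p ∣_) (identity u v) p∣v
    where
    identity : ∀ u v → v ≡ 1ℤ * v - 0ℤ * u
    identity = solve-∀
  ... | no p∤v = Fin.suc (fromℕ< i<p) , subst (λ k → + p ∣ + k * v - 1ℤ * u) (sym (toℕ-fromℕ< i<p)) d
    where
    -- The finite point is the residue of u/v: with s inverse to v, the determinant iv - u is
    -- congruent to (sv - 1)u.
    s = proj₁ (inverse-mod pr p∤v)
    i = (s * u) %ℕ p
    i<p = n%ℕd<d (s * u) p
    k = (s * u) /ℕ p
    identity : ∀ i k p s u v → s * u ≡ i + k * p → i * v - 1ℤ * u ≡ (s * v - 1ℤ) * u - k * v * p
    identity i k p s u v eq = trans (step₁ i k p u v)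
      (trans (cong (λ a → a * v - u - k * v * p) (sym eq)) (step₂ k p s u v))
      where
      step₁ : ∀ i k p u v → i * v - 1ℤ * u ≡ (i + k * p) * v - u - k * v * p
      step₁ = solve-∀
      step₂ : ∀ k p s u v → s * u * v - u - k * v * p ≡ (s * v - 1ℤ) * u - k * v * p
      step₂ = solve-∀
    d : + p ∣ + i * v - 1ℤ * u
    d = subst (+ p ∣_) (sym (identity (+ i) k (+ p) s u v (a≡a%ℕn+[a/ℕn]*n (s * u) p)))
      (∣m∣n⇒∣m-n (∣m⇒∣m*n u (proj₂ (inverse-mod pr p∤v))) (∣n⇒∣m*n (k * v) ∣-refl))

  -- Each coordinate of v times `cross u w` is a combination of `cross u v` and `cross v w`. A
  -- coordinate of v prime to p can then be cancelled.
  ∥-trans : ∀ u v w → ¬ + p ∣² v → u ∥ v → v ∥ w → u ∥ w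
  ∥-trans (a , b) (x , y) (c , d) p∤v h k with + p ∣? x
  ... | no p∤x = [ (λ e → contradiction e p∤x)
    , id ]′ (euclid pr x _ (subst (+ p ∣_) (identity a b x y c d)
      (∣m∣n⇒∣m+n (∣n⇒∣m*n a k) (∣n⇒∣m*n c h))))
    where
    identity : ∀ a b x y c d → a * (x * d - y * c) + c * (a * y - b * x) ≡ x * (a * d - b * c)
    identity = solve-∀
  ... | yes p∣x = [ (λ e → contradiction (p∣x , e) p∤v)
    , id ]′ (euclid pr y _ (subst (+ p ∣_) (identity a b x y c d)
      (∣m∣n⇒∣m+n (∣n⇒∣m*n b k) (∣n⇒∣m*n d h))))
    where
    identity : ∀ a b x y c d → b * (x * d - y * c) + d * (a * y - b * x) ≡ y * (a * d - b * c)
    identity = solve-∀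

  -- Multiplication by ζ is a linear map of determinant 1.
  ζ-∥ : ∀ u v → u ∥ v → ζ· u ∥ ζ· v
  ζ-∥ (a , b) (x , y) = subst (+ p ∣_) (identity a b x y)
    where
    identity : ∀ a b x y → a * y - b * x ≡ - b * (x + y) - (a + b) * - y
    identity = solve-∀

  -- As ζ³ = -1 is a scalar, it acts trivially on the projective line.
  ζ³-∥ : ∀ u v → u ∥ ζ· ζ· ζ· v → u ∥ v
  ζ³-∥ (a , b) (x , y) d = subst (+ p ∣_) (identity a b x y) (∣m⇒∣-m d)
    where
    identity : ∀ a b x y → - (a * (- (x + y) + (- y + (x + y))) - b * - (- y + (x + y))) ≡ a * y - b * x
    identity = solve-∀

  finite-injective : ∀ {i j} → i ℕ.≤ j → j < p → + p ∣ + j - + i → i ≡ j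
  finite-injective {i} {j} i≤j j<p d = ℕ.≤-antisym i≤j (ℕ.m∸n≡0⇒m≤n (small (∣⇒∣ᵤ {+ p} {+ (j ℕ.∸ i)}
      (subst (+ p ∣_) (trans (ℤ.m-n≡m⊖n j i) (ℤ.⊖-≥ i≤j)) d)) (ℕ.≤-<-trans (ℕ.m∸n≤m j i) j<p)))
    where
    small : ∀ {m} → p ℕ.∣ m → m < p → m ≡ 0
    small {zero}  _ _ = refl
    small {suc m} e m<p = contradiction e (ℕ.>⇒∤ m<p)

  point-injective : ∀ {i j} → point i ∥ point j → i ≡ j
  point-injective {Fin.zero}  {Fin.zero}  _ = refl
  point-injective {Fin.zero}  {Fin.suc j} d = contradiction (subst (+ p ∣_) (identity (+ toℕ j)) d) p∤1
    where
    identity : ∀ j → 1ℤ * 1ℤ - 0ℤ * j ≡ 1ℤ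
    identity = solve-∀
  point-injective {Fin.suc i} {Fin.zero}  d =
    contradiction (subst (+ p ∣_) (identity (+ toℕ i)) (∣m⇒∣-m d)) p∤1
    where
    identity : ∀ i → - (i * 0ℤ - 1ℤ * 1ℤ) ≡ 1ℤ
    identity = solve-∀
  point-injective {Fin.suc i} {Fin.suc j} d = cong Fin.suc (toℕ-injective
    ([ (λ i≤j → finite-injective i≤j (toℕ<n j)
      (subst (+ p ∣_) (identity′ (+ toℕ i) (+ toℕ j)) (∣m⇒∣-m d)))
     , (λ j≤i → sym (finite-injective j≤i (toℕ<n i)
       (subst (+ p ∣_) (identity (+ toℕ i) (+ toℕ j)) d))) ]′
     (ℕ.≤-total (toℕ i) (toℕ j))))
    where
    identity : ∀ i j → i * 1ℤ - 1ℤ * j ≡ i - j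
    identity = solve-∀
    identity′ : ∀ i j → - (i * 1ℤ - 1ℤ * j) ≡ j - i
    identity′ = solve-∀

  rotate : Fin (suc p) → Fin (suc p)
  rotate i = proj₁ (normalise (ζ-nonzero {point i} (point-nonzero i)))

  rotate-∥ : ∀ i → point (rotate i) ∥ ζ· point i
  rotate-∥ i = proj₂ (normalise (ζ-nonzero {point i} (point-nonzero i)))

  rotate³ : ∀ i → rotate (rotate (rotate i)) ≡ i
  -- The representative of each rotation is proportional to ζ times the previous one. Chaining three
  -- such relations makes `point i‴` proportional to ζ³ times `point i`.
  rotate³ i = point-injective (ζ³-∥ (point i‴) (point i)
    (∥-trans (point i‴) (ζ· ζ· point i′) (ζ· ζ· ζ· point i) ζζ-nonzero
      (∥-trans (point i‴) (ζ· point i″) (ζ· ζ· point i′) (ζ-nonzero {point i″} (point-nonzero i″))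
        (rotate-∥ i″) (ζ-∥ (point i″) (ζ· point i′) (rotate-∥ i′)))
      (ζ-∥ (ζ· point i′) (ζ· ζ· point i) (ζ-∥ (point i′) (ζ· point i) (rotate-∥ i)))))
    where
    i′ = rotate i
    i″ = rotate i′
    i‴ = rotate i″
    ζζ-nonzero : ¬ + p ∣² ζ· ζ· point i′
    ζζ-nonzero = ζ-nonzero {ζ· point i′} (ζ-nonzero {point i′} (point-nonzero i′))

  -- This is why fixed points matter: z and ζz span the same point modulo p exactly when the norm of
  -- z vanishes modulo p.
  cross-ζ : ∀ z → cross z (ζ· z) ≡ norm z
  cross-ζ (x , y) = identity x y
    where
    identity : ∀ x y → x * (x + y) - y * - y ≡ x * x + x * y + y * y
    identity = solve-∀

  isotropic : ¬ 3 ℕ.∣ suc p → ∃ λ z → (+ p ∣ norm z) × (¬ + p ∣² z)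
  isotropic 3∤1+p with any? (λ i → rotate i Fin.≟ i)
  ... | no none = contradiction (order-3-no-fixpoint⇒3∣ rotate rotate³ (λ i eq → none (i , eq))) 3∤1+p
  ... | yes (i , eq) = point i , subst (+ p ∣_) (cross-ζ (point i))
    (subst (λ k → point k ∥ ζ· point i) eq (rotate-∥ i)) , point-nonzero i

-- Divisor sums of the character modulo 3

χ : ℕ → ℤ
χ 0 = 0ℤ
χ 1 = 1ℤ
χ 2 = -1ℤ
χ (suc (suc (suc n))) = χ n

-- The brackets are those to which `suc (suc (suc a)) ℕ.* d` unfolds, as multiplicativity of χ
-- needs.
χ-+3* : ∀ d m → χ (d ℕ.+ (d ℕ.+ (d ℕ.+ m))) ≡ χ m
χ-+3* zero    m = refl
χ-+3* (suc d) m = trans (cong χ (rearrange d m)) (χ-+3* d m)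
  where
  rearrange : ∀ d m → suc d ℕ.+ (suc d ℕ.+ (suc d ℕ.+ m)) ≡ 3 ℕ.+ (d ℕ.+ (d ℕ.+ (d ℕ.+ m)))
  rearrange = ℕ-Solver.solve-∀

χ-* : ∀ a d → χ (a ℕ.* d) ≡ χ a * χ d
χ-* 0 d = refl
χ-* 1 d = trans (cong χ (ℕ.*-identityˡ d)) (sym (ℤ.*-identityˡ (χ d)))
χ-* 2 d = trans (double d) (sym (ℤ.-1*i≡-i (χ d)))
  where
  double : ∀ d → χ (2 ℕ.* d) ≡ - χ d
  double 0 = refl
  double 1 = refl
  double 2 = refl
  double (suc (suc (suc d))) = trans (cong χ (rearrange d)) (double d)
    where
    rearrange : ∀ d → 2 ℕ.* suc (suc (suc d)) ≡ 6 ℕ.+ 2 ℕ.* d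
    rearrange = ℕ-Solver.solve-∀
χ-* (suc (suc (suc a))) d = trans (χ-+3* d (a ℕ.* d)) (χ-* a d)

∑< : ℕ → (ℕ → ℤ) → ℤ
∑< zero    f = 0ℤ
∑< (suc n) f = f 0 + ∑< n (f ∘ suc)

∑-cong-< : ∀ n {f g : ℕ → ℤ} → (∀ {k} → k < n → f k ≡ g k) → ∑< n f ≡ ∑< n g
∑-cong-< zero    eq = refl
∑-cong-< (suc n) eq = cong₂ _+_ (eq ℕ.z<s) (∑-cong-< n (eq ∘ s≤s))

∑-cong : ∀ n {f g : ℕ → ℤ} → (∀ k → f k ≡ g k) → ∑< n f ≡ ∑< n g
∑-cong n eq = ∑-cong-< n (λ {k} _ → eq k)

∑-zero : ∀ n {f : ℕ → ℤ} → (∀ {k} → k < n → f k ≡ 0ℤ) → ∑< n f ≡ 0ℤ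
∑-zero zero    eq = refl
∑-zero (suc n) eq = cong₂ _+_ (eq ℕ.z<s) (∑-zero n (eq ∘ s≤s))

∑-+ : ∀ n f g → ∑< n (λ k → f k + g k) ≡ ∑< n f + ∑< n g
∑-+ zero    f g = refl
∑-+ (suc n) f g = trans (cong (_+_ (f 0 + g 0)) (∑-+ n (f ∘ suc) (g ∘ suc)))
  (interchange (f 0) (g 0) (∑< n (f ∘ suc)) (∑< n (g ∘ suc)))
  where
  interchange : ∀ a b c d → a + b + (c + d) ≡ a + c + (b + d)
  interchange = solve-∀

∑-* : ∀ n c f → ∑< n (λ k → c * f k) ≡ c * ∑< n f
∑-* zero    c f = sym (ℤ.*-zeroʳ c)
∑-* (suc n) c f = trans (cong (_+_ (c * f 0)) (∑-* n c (f ∘ suc))) (sym (ℤ.*-distribˡ-+ c (f 0) _))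

∑-split : ∀ m n f → ∑< (m ℕ.+ n) f ≡ ∑< m f + ∑< n (λ k → f (m ℕ.+ k))
∑-split zero    n f = sym (ℤ.+-identityˡ _)
∑-split (suc m) n f = trans (cong (_+_ (f 0)) (∑-split m n (f ∘ suc))) (sym (ℤ.+-assoc (f 0) _ _))

∑-extend : ∀ {m n} f → m ≤ n → (∀ {k} → m ≤ k → f k ≡ 0ℤ) → ∑< n f ≡ ∑< m f
∑-extend {m} {n} f m≤n f≡0 = begin
  ∑< n f                                          ≡⟨ cong (λ k → ∑< k f) (ℕ.m+[n∸m]≡n m≤n) ⟨
  ∑< (m ℕ.+ (n ℕ.∸ m)) f                          ≡⟨ ∑-split m (n ℕ.∸ m) f ⟩
  ∑< m f + ∑< (n ℕ.∸ m) (λ k → f (m ℕ.+ k))       ≡⟨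
    cong (_+_ (∑< m f)) (∑-zero (n ℕ.∸ m) (λ {k} _ → f≡0 (ℕ.m≤m+n m k))) ⟩
  ∑< m f + 0ℤ                                     ≡⟨ ℤ.+-identityʳ _ ⟩
  ∑< m f                                          ∎

-- The range is cut into n blocks of length p, in each of which only the first index is a multiple
-- of p.
∑-multiples : ∀ p .{{_ : NonZero p}} n f → (∀ {k} → ¬ p ℕ.∣ k → f k ≡ 0ℤ) →
  ∑< (n ℕ.* p) f ≡ ∑< n (λ i → f (i ℕ.* p))
∑-multiples p zero    f f≡0 = refl
∑-multiples p@(suc p-1) (suc n) f f≡0 = begin
  ∑< (p ℕ.+ n ℕ.* p) f                                         ≡⟨ ∑-split p (n ℕ.* p) f ⟩
  f 0 + ∑< p-1 (f ∘ suc) + ∑< (n ℕ.* p) (λ k → f (p ℕ.+ k))    ≡⟨ cong₂ _+_ first rest ⟩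
  f 0 + ∑< n (λ i → f (suc i ℕ.* p))                           ∎
  where
  first : f 0 + ∑< p-1 (f ∘ suc) ≡ f 0
  first = trans (cong (_+_ (f 0)) (∑-zero p-1 (λ k<p-1 → f≡0 (ℕ.>⇒∤ (s≤s k<p-1)))))
    (ℤ.+-identityʳ (f 0))
  rest : ∑< (n ℕ.* p) (λ k → f (p ℕ.+ k)) ≡ ∑< n (λ i → f (suc i ℕ.* p))
  rest = ∑-multiples p n (λ k → f (p ℕ.+ k)) (λ p∤k → f≡0 (p∤k ∘ λ p∣p+k → ℕ.∣m+n∣m⇒∣n p∣p+k ℕ.∣-refl))

when : ∀ {A : Set} → Dec A → ℤ → ℤ
when (yes _) x = x
when (no _)  _ = 0ℤ

unless : ∀ {A : Set} → Dec A → ℤ → ℤ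
unless (yes _) _ = 0ℤ
unless (no _)  x = x

when-unless : ∀ {A : Set} (d : Dec A) x → x ≡ when d x + unless d x
when-unless (yes _) x = sym (ℤ.+-identityʳ x)
when-unless (no _)  x = sym (ℤ.+-identityˡ x)

when-yes : ∀ {A : Set} (d : Dec A) {x} → A → when d x ≡ x
when-yes (yes _) _ = refl
when-yes (no ¬a) a = contradiction a ¬a

when-no : ∀ {A : Set} (d : Dec A) {x} → ¬ A → when d x ≡ 0ℤ
when-no (yes a) ¬a = contradiction a ¬a
when-no (no _)  _  = refl

unless-cong : ∀ {A : Set} (d : Dec A) {x c y} → (¬ A → x ≡ c * y) → unless d x ≡ c * unless d y
unless-cong (yes _) {c = c} _ = sym (ℤ.*-zeroʳ c)
unless-cong (no ¬a) eq = eq ¬a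

-- Extending χ(j/k) by zero to k not dividing j turns sums over divisors into sums over initial
-- segments, whose upper bound can be enlarged at will.
χ[_/_] : ℕ → ℕ → ℤ
χ[ j / k ] with k ℕ.∣? j
... | yes (ℕ.divides q _) = χ q
... | no _                = 0ℤ

χ/-quotient : ∀ j k q .{{_ : NonZero k}} → j ≡ q ℕ.* k → χ[ j / k ] ≡ χ q
χ/-quotient j k q eq with k ℕ.∣? j
... | yes (ℕ.divides q′ eq′) = cong χ (ℕ.*-cancelʳ-≡ q′ q k (trans (sym eq′) eq))
... | no k∤j                 = contradiction (ℕ.divides q eq) k∤j

χ/-∤ : ∀ j k → ¬ k ℕ.∣ j → χ[ j / k ] ≡ 0ℤ
χ/-∤ j k k∤j with k ℕ.∣? j
... | yes k∣j = contradiction k∣j k∤j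
... | no _    = refl

χ/-> : ∀ j k .{{_ : NonZero j}} → j < k → χ[ j / k ] ≡ 0ℤ
χ/-> j k j<k = χ/-∤ j k (ℕ.>⇒∤ j<k)

χ/-scale : ∀ p j .{{_ : NonZero p}} .{{_ : NonZero j}} k → χ[ p ℕ.* j / k ℕ.* p ] ≡ χ[ j / k ]
χ/-scale p j k with k ℕ.∣? j
... | no k∤j = χ/-∤ (p ℕ.* j) (k ℕ.* p) (k∤j ∘ ℕ.*-cancelˡ-∣ p ∘ subst (ℕ._∣ p ℕ.* j) (ℕ.*-comm k p))
χ/-scale p j zero | yes 0∣j = contradiction (ℕ.0∣⇒≡0 0∣j) (ℕ.≢-nonZero⁻¹ j)
χ/-scale p j k@(suc _) | yes (ℕ.divides q eq) = χ/-quotient (p ℕ.* j) (k ℕ.* p) q {{ℕ.m*n≢0 k p}} (begin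
  p ℕ.* j            ≡⟨ cong (p ℕ.*_) eq ⟩
  p ℕ.* (q ℕ.* k)    ≡⟨ rearrange p q k ⟩
  q ℕ.* (k ℕ.* p)    ∎)
  where
  rearrange : ∀ p q k → p ℕ.* (q ℕ.* k) ≡ q ℕ.* (k ℕ.* p)
  rearrange = ℕ-Solver.solve-∀

-- For k prime to p, the conditions k ∣ pj and k ∣ j are equivalent, and the quotient gains the
-- factor p.
χ/-prime : ∀ {p} → Prime p → ∀ j .{{_ : NonZero j}} {k} → ¬ p ℕ.∣ k →
  χ[ p ℕ.* j / k ] ≡ χ p * χ[ j / k ]
χ/-prime {p} pr j {k} p∤k with k ℕ.∣? j
... | no k∤j = trans (χ/-∤ (p ℕ.* j) k (k∤j ∘ coprime-divisor coprime)) (sym (ℤ.*-zeroʳ (χ p)))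
  where
  coprime : Coprime k p
  coprime (d∣k , d∣p) = [ id , (λ { refl → contradiction d∣k p∤k }) ]′ (prime⇒irreducible pr d∣p)
χ/-prime {p} pr j {zero} p∤k | yes _ = contradiction (p ℕ.∣0) p∤k
χ/-prime {p} pr j {k@(suc _)} p∤k | yes (ℕ.divides q eq) =
  trans (χ/-quotient (p ℕ.* j) k (p ℕ.* q) (trans (cong (p ℕ.*_) eq) (sym (ℕ.*-assoc p q k)))) (χ-* p q)

-- For positive j the index k = 0 contributes nothing. Starting there makes the multiples of p in
-- the range equally spaced from its first index.
σ : ℕ → ℤ
σ j = ∑< (suc j) (λ k → χ[ j / k ])

σ-extend : ∀ j .{{_ : NonZero j}} {n} → j < n → ∑< n (λ k → χ[ j / k ]) ≡ σ j
σ-extend j j<n = ∑-extend _ j<n (λ {k} → χ/-> j k)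

module _ {p} (pr : Prime p) where
  private instance
    p≢0 : NonZero p
    p≢0 = prime⇒nonZero pr

  ∑-∣-∤ : ∀ n f → ∑< (n ℕ.* p) f ≡ ∑< n (λ i → f (i ℕ.* p))
    + ∑< (n ℕ.* p) (λ k → unless (p ℕ.∣? k) (f k))
  ∑-∣-∤ n f = begin
    ∑< (n ℕ.* p) f
      ≡⟨ ∑-cong (n ℕ.* p) (λ k → when-unless (p ℕ.∣? k) (f k)) ⟩
    ∑< (n ℕ.* p) (λ k → when (p ℕ.∣? k) (f k) + unless (p ℕ.∣? k) (f k))
      ≡⟨ ∑-+ (n ℕ.* p) _ _ ⟩
    ∑< (n ℕ.* p) (λ k → when (p ℕ.∣? k) (f k)) + rest
      ≡⟨ cong (_+ rest) (trans (∑-multiples p n _ (λ {k} → when-no (p ℕ.∣? k)))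
           (∑-cong n (λ i → when-yes (p ℕ.∣? (i ℕ.* p)) (ℕ.n∣m*n i)))) ⟩
    ∑< n (λ i → f (i ℕ.* p)) + rest ∎
    where rest = ∑< (n ℕ.* p) (λ k → unless (p ℕ.∣? k) (f k))

  j<1+j*p : ∀ j → j < suc j ℕ.* p
  j<1+j*p j = ℕ.m≤m*n (suc j) p

  -- The range is extended to (j + 1)p. Indices ip contribute χ(j/i), in total σ(j); indices prime
  -- to p contribute χ(p) times their terms in σ(j), and these terms amount to σ(j) minus the sum
  -- over multiples of p, which plays the role of σ(j/p).
  σ-recursion : ∀ j .{{_ : NonZero j}} →
    σ (p ℕ.* j) ≡ σ j + χ p * (σ j - ∑< (suc j) (λ i → χ[ j / i ℕ.* p ]))
  σ-recursion j = begin
    σ (p ℕ.* j)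
      ≡⟨ σ-extend (p ℕ.* j) {{ℕ.m*n≢0 p j}} pj<np ⟨
    ∑< np (λ k → χ[ p ℕ.* j / k ])
      ≡⟨ ∑-∣-∤ (suc j) _ ⟩
    ∑< (suc j) (λ i → χ[ p ℕ.* j / i ℕ.* p ]) + ∑< np (λ k → unless (p ℕ.∣? k) χ[ p ℕ.* j / k ])
      ≡⟨ cong₂ _+_ (∑-cong (suc j) (χ/-scale p j))
           (trans (∑-cong np (λ k → unless-cong (p ℕ.∣? k) {c = χ p} {χ[ j / k ]}
             (χ/-prime pr j {k}))) (∑-* np (χ p) _)) ⟩
    σ j + χ p * U
      ≡⟨ cong (λ u → σ j + χ p * u) (trans (cancel U S)
        (cong (_- S) (trans (sym (∑-∣-∤ (suc j) _)) (σ-extend j (j<1+j*p j))))) ⟩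
    σ j + χ p * (σ j - S) ∎
    where
    np = suc j ℕ.* p
    U = ∑< np (λ k → unless (p ℕ.∣? k) χ[ j / k ])
    S = ∑< (suc j) (λ i → χ[ j / i ℕ.* p ])
    pj<np : p ℕ.* j < np
    pj<np = subst (_< np) (ℕ.*-comm j p) (ℕ.*-monoˡ-< p (ℕ.n<1+n j))
    cancel : ∀ u s → u ≡ s + u - s
    cancel = solve-∀

  σ-∤ : ∀ j .{{_ : NonZero j}} → ¬ p ℕ.∣ j → σ (p ℕ.* j) ≡ σ j + χ p * σ j
  σ-∤ j p∤j = trans (σ-recursion j) (cong (λ s → σ j + χ p * s)
    (trans (cong (_-_ (σ j)) (∑-zero (suc j)
      (λ {i} _ → χ/-∤ j (i ℕ.* p) (p∤j ∘ ℕ.∣-trans (ℕ.n∣m*n i))))) (ℤ.+-identityʳ (σ j))))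

  σ-∣ : ∀ m .{{_ : NonZero m}} → σ (p ℕ.* (p ℕ.* m)) ≡ σ (p ℕ.* m) + χ p * (σ (p ℕ.* m) - σ m)
  σ-∣ m = trans (σ-recursion (p ℕ.* m) {{ℕ.m*n≢0 p m}})
    (cong (λ s → σ (p ℕ.* m) + χ p * (σ (p ℕ.* m) - s))
    (trans (∑-cong (suc (p ℕ.* m)) (χ/-scale p m)) (σ-extend m (s≤s (ℕ.m≤n*m m p)))))

[_≡1mod3] : ℕ → ℤ
[ 0 ≡1mod3] = 0ℤ
[ 1 ≡1mod3] = 1ℤ
[ 2 ≡1mod3] = 0ℤ
[ suc (suc (suc n)) ≡1mod3] = [ n ≡1mod3]

-- The indicator of q ≡ 1 modulo 3 is the partial sum χ(1) + ... + χ(q).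
≡1mod3-suc : ∀ q → [ suc q ≡1mod3] ≡ [ q ≡1mod3] + χ (suc q)
≡1mod3-suc 0 = refl
≡1mod3-suc 1 = refl
≡1mod3-suc 2 = refl
≡1mod3-suc (suc (suc (suc q))) = ≡1mod3-suc q

/-unique : ∀ {n k q r} .{{_ : NonZero k}} → n ≡ r ℕ.+ q ℕ.* k → r < k → n ℕ./ k ≡ q
/-unique {n} {k} {q} {r} refl r<k = begin
  (r ℕ.+ q ℕ.* k) ℕ./ k         ≡⟨ ℕ.+-distrib-/-∣ʳ r (ℕ.n∣m*n q) ⟩
  r ℕ./ k ℕ.+ q ℕ.* k ℕ./ k     ≡⟨ cong₂ ℕ._+_ (ℕ.m<n⇒m/n≡0 r<k) (ℕ.m*n/n≡m q k) ⟩
  q                             ∎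

-- From n to n + 1 the quotient by k changes only if k divides n + 1. It then rises by one to (n +
-- 1)/k, and the indicator changes by χ of this value.
≡1mod3-/-suc : ∀ n k .{{_ : NonZero k}} → [ suc n ℕ./ k ≡1mod3] ≡ [ n ℕ./ k ≡1mod3] + χ[ suc n / k ]
≡1mod3-/-suc n k = [ below , exact ]′ (ℕ.m≤n⇒m<n∨m≡n (ℕ.m%n<n n k))
  where
  q = n ℕ./ k
  r = n ℕ.% k
  1+n≡ : suc n ≡ suc r ℕ.+ q ℕ.* k
  1+n≡ = cong suc (ℕ.m≡m%n+[m/n]*n n k)
  below : suc r < k → [ suc n ℕ./ k ≡1mod3] ≡ [ q ≡1mod3] + χ[ suc n / k ]
  below 1+r<k = begin
    [ suc n ℕ./ k ≡1mod3]             ≡⟨ cong [_≡1mod3] (/-unique {suc n} {k} {q} {suc r} 1+n≡ 1+r<k) ⟩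
    [ q ≡1mod3]                       ≡⟨ ℤ.+-identityʳ _ ⟨
    [ q ≡1mod3] + 0ℤ                  ≡⟨ cong (_+_ [ q ≡1mod3]) (χ/-∤ (suc n) k k∤1+n) ⟨
    [ q ≡1mod3] + χ[ suc n / k ]      ∎
    where
    k∤1+n : ¬ k ℕ.∣ suc n
    k∤1+n d = contradiction (ℕ.∣m+n∣m⇒∣n (subst (k ℕ.∣_) (trans 1+n≡ (ℕ.+-comm (suc r) (q ℕ.* k))) d)
      (ℕ.n∣m*n q)) (ℕ.>⇒∤ 1+r<k)
  exact : suc r ≡ k → [ suc n ℕ./ k ≡1mod3] ≡ [ q ≡1mod3] + χ[ suc n / k ]
  exact 1+r≡k = begin
    [ suc n ℕ./ k ≡1mod3]             ≡⟨
      cong [_≡1mod3] (trans (ℕ./-congˡ {o = k} 1+n≡1+q*k) (ℕ.m*n/n≡m (suc q) k)) ⟩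
    [ suc q ≡1mod3]                   ≡⟨ ≡1mod3-suc q ⟩
    [ q ≡1mod3] + χ (suc q)           ≡⟨
      cong (_+_ [ q ≡1mod3]) (χ/-quotient (suc n) k (suc q) 1+n≡1+q*k) ⟨
    [ q ≡1mod3] + χ[ suc n / k ]      ∎
    where
    1+n≡1+q*k : suc n ≡ suc q ℕ.* k
    1+n≡1+q*k = trans 1+n≡ (cong (ℕ._+ q ℕ.* k) 1+r≡k)

quotients≡1mod3 : ℕ → ℤ
quotients≡1mod3 n = ∑< n (λ k → [ n ℕ./ suc k ≡1mod3])

quotients≡1mod3-suc : ∀ n → quotients≡1mod3 (suc n) ≡ quotients≡1mod3 n + σ (suc n)
quotients≡1mod3-suc n = begin
  quotients≡1mod3 (suc n)
    ≡⟨ ∑-cong (suc n) (λ k → ≡1mod3-/-suc n (suc k)) ⟩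
  ∑< (suc n) (λ k → [ n ℕ./ suc k ≡1mod3] + χ[ suc n / suc k ])
    ≡⟨ ∑-+ (suc n) (λ k → [ n ℕ./ suc k ≡1mod3]) (λ k → χ[ suc n / suc k ]) ⟩
  ∑< (suc n) (λ k → [ n ℕ./ suc k ≡1mod3]) + ∑< (suc n) (λ k → χ[ suc n / suc k ])
    -- The extra index k = n in the first sum has quotient n/(n + 1) = 0. The second sum lacks only
    -- the vanishing term of σ at divisor 0.
    ≡⟨ cong₂ _+_ (∑-extend _ (ℕ.n≤1+n n)
      (λ {k} n≤k → cong [_≡1mod3] (ℕ.m<n⇒m/n≡0 {n} {suc k} (s≤s n≤k)))) (begin
         D                          ≡⟨ ℤ.+-identityˡ D ⟨
         0ℤ + D                     ≡⟨ cong (_+ D)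
           (χ/-∤ (suc n) 0 (λ d → contradiction (ℕ.0∣⇒≡0 d) (λ ()))) ⟨
         σ (suc n)                  ∎) ⟩
  quotients≡1mod3 n + σ (suc n) ∎
  where
  D = ∑< (suc n) (λ k → χ[ suc n / suc k ])

-- Quotients and floors

-- A rational is stored in lowest terms, so its numerator and denominator need not be n and k + 1.
-- Cross-multiplication compares the two quotients.
floor-≃ : ∀ q n k → toℚᵘ q ≃ mkℚᵘ (+ n) k → floor q ≡ + (n ℕ./ suc k)
floor-≃ (mkℚ (+ a) d _) n k (*≡* eq) = trans (div-pos-is-/ℕ (+ a) (suc d)) (cong +_ (begin
  a ℕ./ suc d                                  ≡⟨ ℕ.m*n/o*n≡m/o a (suc k) (suc d) ⟨
  (a ℕ.* suc k) ℕ./ (suc d ℕ.* suc k)          ≡⟨ ℕ./-congˡ {o = suc d ℕ.* suc k} a*k≡n*d ⟩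
  (n ℕ.* suc d) ℕ./ (suc d ℕ.* suc k)          ≡⟨
    ℕ./-congʳ {m = n ℕ.* suc d} (ℕ.*-comm (suc d) (suc k)) ⟩
  (n ℕ.* suc d) ℕ./ (suc k ℕ.* suc d)          ≡⟨ ℕ.m*n/o*n≡m/o n (suc d) (suc k) ⟩
  n ℕ./ suc k                                  ∎))
  where
  a*k≡n*d : a ℕ.* suc k ≡ n ℕ.* suc d
  a*k≡n*d = ℤ.+-injective (trans (ℤ.pos-* a (suc k)) (trans eq (sym (ℤ.pos-* n (suc d)))))
floor-≃ (mkℚ -[1+ a ] d _) n k (*≡* eq) with () ← trans eq (sym (ℤ.pos-* n (suc d)))

⌊n/k⌋ : ∀ n k → ⌊[ n - 0ℚ ]/ suc k + 0ℚ ⌋ ≡ + (n ℕ./ suc k)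
⌊n/k⌋ n k = trans (cong floor (trans (ℚ.+-identityʳ ((+ n ℚ./ 1 ℚ.- 0ℚ) ℚ.* (1ℤ ℚ./ suc k)))
                                        (cong (ℚ._* (1ℤ ℚ./ suc k)) (ℚ.+-identityʳ (+ n ℚ./ 1)))))
  (floor-≃ ((+ n ℚ./ 1) ℚ.* (1ℤ ℚ./ suc k)) n k
    (ℚᵘ.≃-trans (ℚ.toℚᵘ-homo-* (+ n ℚ./ 1) (1ℤ ℚ./ suc k))
    (ℚᵘ.≃-trans (ℚᵘ.*-cong (ℚ.toℚᵘ-fromℚᵘ (mkℚᵘ (+ n) 0)) (ℚ.toℚᵘ-fromℚᵘ (mkℚᵘ 1ℤ k)))
      (*≡* (cong₂ _*_ (ℤ.*-identityʳ (+ n)) (cong +_ (sym (ℕ.*-identityˡ (suc k)))))))))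

3∣-suc³ : ∀ n → + 3 ∣ + suc (suc (suc n)) - 1ℤ → + 3 ∣ + n - 1ℤ
3∣-suc³ n d = ∣m+n∣m⇒∣n {+ 3} {+ 3} (subst (+ 3 ∣_) (shift (+ n)) d) ∣-refl
  where
  shift : ∀ n → + 3 + n - 1ℤ ≡ + 3 + (n - 1ℤ)
  shift = solve-∀

≡1mod3-yes : ∀ q → + 3 ∣ + q - 1ℤ → [ q ≡1mod3] ≡ 1ℤ
≡1mod3-yes 0 d = contradiction d (from-no (+ 3 ∣? -1ℤ))
≡1mod3-yes 1 d = refl
≡1mod3-yes 2 d = contradiction d (from-no (+ 3 ∣? 1ℤ))
≡1mod3-yes (suc (suc (suc q))) d = ≡1mod3-yes q (3∣-suc³ q d)

≡1mod3-no : ∀ q → ¬ + 3 ∣ + q - 1ℤ → [ q ≡1mod3] ≡ 0ℤ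
≡1mod3-no 0 _ = refl
≡1mod3-no 1 ¬d = contradiction (divides 0ℤ refl) ¬d
≡1mod3-no 2 _ = refl
≡1mod3-no (suc (suc (suc q))) ¬d = ≡1mod3-no q
  (λ d → ¬d (subst (+ 3 ∣_) (shift (+ q)) (∣m∣n⇒∣m+n (∣-refl {+ 3}) d)))
  where
  shift : ∀ n → + 3 + (n - 1ℤ) ≡ + 3 + n - 1ℤ
  shift = solve-∀

-- The enumeration `g` is arbitrary because the induction passes from `g` to `g ∘ suc`.
length-filter : ∀ {P : ℕ → Set} (P? : ∀ k → Dec (P k)) (f : ℕ → ℤ) → (∀ k → P k → f k ≡ 1ℤ) →
  (∀ k → ¬ P k → f k ≡ 0ℤ) →
                ∀ n g → + length (filter P? (applyUpTo g n)) ≡ ∑< n (f ∘ g)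
length-filter P? f f≡1 f≡0 zero    g = refl
length-filter P? f f≡1 f≡0 (suc n) g with P? (g 0)
... | yes p = trans (ℤ.pos-+ 1 _) (cong₂ _+_ (sym (f≡1 (g 0) p))
  (length-filter P? f f≡1 f≡0 n (g ∘ suc)))
... | no ¬p = trans (sym (ℤ.+-identityˡ _))
  (cong₂ _+_ (sym (f≡0 (g 0) ¬p)) (length-filter P? f f≡1 f≡0 n (g ∘ suc)))

𝒩≡quotients≡1mod3 : ∀ n .{{_ : NonZero n}} → + 𝒩 n 0ℚ 0ℚ 1ℤ 3 ≡ quotients≡1mod3 n
𝒩≡quotients≡1mod3 n = length-filter (λ i → ⌊[ n - 0ℚ ]/ suc i + 0ℚ ⌋ ≡? 1ℤ [mod 3 ])
  (λ i → [ n ℕ./ suc i ≡1mod3])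
  (λ i d → ≡1mod3-yes (n ℕ./ suc i) (subst (λ q → + 3 ∣ q - 1ℤ) (⌊n/k⌋ n i) d))
  (λ i ¬d → ≡1mod3-no (n ℕ./ suc i) (¬d ∘ subst (λ q → + 3 ∣ q - 1ℤ) (sym (⌊n/k⌋ n i))))
  n id

-- Residues and norms modulo 3

mod3 : ∀ n → ∃ λ q → (n ≡ q ℕ.* 3) ⊎ (n ≡ 1 ℕ.+ q ℕ.* 3) ⊎ (n ≡ 2 ℕ.+ q ℕ.* 3)
mod3 0 = 0 , inj₁ refl
mod3 1 = 0 , inj₂ (inj₁ refl)
mod3 2 = 0 , inj₂ (inj₂ refl)
mod3 (suc (suc (suc n))) with mod3 n
... | q , inj₁ refl        = suc q , inj₁ refl
... | q , inj₂ (inj₁ refl) = suc q , inj₂ (inj₁ refl)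
... | q , inj₂ (inj₂ refl) = suc q , inj₂ (inj₂ refl)

χ-+*3 : ∀ r q → χ (r ℕ.+ q ℕ.* 3) ≡ χ r
χ-+*3 r q = trans (cong χ (rearrange r q)) (χ-+3* q r)
  where
  rearrange : ∀ r q → r ℕ.+ q ℕ.* 3 ≡ q ℕ.+ (q ℕ.+ (q ℕ.+ r))
  rearrange = ℕ-Solver.solve-∀

3∤square-2 : ∀ s → ¬ + 3 ∣ s * s - + 2
3∤square-2 s d = excluded (s %ℕ 3) (n%ℕd<d s 3)
  (∣m+n∣n⇒∣m {+ 3} {r * r - + 2} (subst (+ 3 ∣_) s²≡ d) (∣n⇒∣m*n (+ 2 * r * k + + 3 * k * k) ∣-refl))
  where
  r k : ℤ
  r = + (s %ℕ 3)
  k = s /ℕ 3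
  identity : ∀ r k → (r + k * + 3) * (r + k * + 3) - + 2 ≡ r * r - + 2 + (+ 2 * r * k + + 3 * k * k)
    * + 3
  identity = solve-∀
  s²≡ : s * s - + 2 ≡ r * r - + 2 + (+ 2 * r * k + + 3 * k * k) * + 3
  s²≡ = trans (cong (λ x → x * x - + 2) (a≡a%ℕn+[a/ℕn]*n s 3)) (identity r k)
  excluded : ∀ r → r < 3 → ¬ + 3 ∣ + r * + r - + 2
  excluded 0 _ = from-no (+ 3 ∣? - + 2)
  excluded 1 _ = from-no (+ 3 ∣? -1ℤ)
  excluded 2 _ = from-no (+ 3 ∣? + 2)
  excluded (suc (suc (suc _))) (s≤s (s≤s (s≤s ())))

-- The norm is (a - b)² + 3ab, hence a square modulo 3.
norm≢2mod3 : ∀ w q → norm w ≢ + (2 ℕ.+ q ℕ.* 3)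
norm≢2mod3 (a , b) q eq = 3∤square-2 (a - b) (divides (+ q - a * b) (begin
  (a - b) * (a - b) - + 2                     ≡⟨ identity₁ a b ⟩
  norm (a , b) - + 2 - + 3 * (a * b)          ≡⟨
    cong (λ n → n - + 2 - + 3 * (a * b))
    (trans eq (trans (ℤ.pos-+ 2 (q ℕ.* 3)) (cong (_+_ (+ 2)) (ℤ.pos-* q 3)))) ⟩
  + 2 + + q * + 3 - + 2 - + 3 * (a * b)       ≡⟨ identity₂ (+ q) (a * b) ⟩
  (+ q - a * b) * + 3                         ∎))
  where
  identity₁ : ∀ a b → (a - b) * (a - b) - + 2 ≡ a * a + a * b + b * b - + 2 - + 3 * (a * b)
  identity₁ = solve-∀
  identity₂ : ∀ q c → + 2 + q * + 3 - + 2 - + 3 * c ≡ (q - c) * + 3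
  identity₂ = solve-∀

-- Counting lattice points

-- The bounds 3x² ≤ 4 and 3y² ≤ 4 leave nine candidates. The origin has norm 0, (1, 1) and (-1, -1)
-- have norm 3, and the other six are the units.
card-Rep-1 : HasCard (Rep 1) (+ 6)
card-Rep-1 = 6 , mk↔ₛ′ to from to∘from from∘to , refl
  where
  units : Fin 6 → 𝔼
  units 0F = 1ℤ , 0ℤ
  units 1F = 0ℤ , 1ℤ
  units 2F = -1ℤ , 1ℤ
  units 3F = -1ℤ , 0ℤ
  units 4F = 0ℤ , -1ℤ
  units 5F = 1ℤ , -1ℤ
  from : Fin 6 → Rep 1
  from 0F = units 0F , refl
  from 1F = units 1F , refl
  from 2F = units 2F , refl
  from 3F = units 3F , refl
  from 4F = units 4F , refl
  from 5F = units 5F , refl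
  small : ∀ n → 3 ℕ.* (n ℕ.* n) ≤ 4 → n ≤ 1
  small 0 _ = z≤n
  small 1 _ = s≤s z≤n
  small n@(suc (suc m)) le = contradiction
    (ℕ.≤-trans (ℕ.*-monoʳ-≤ 3 (ℕ.*-mono-≤ {2} {n} {2} {n} (s≤s (s≤s z≤n)) (s≤s (s≤s z≤n)))) le)
    (from-no (12 ℕ.≤? 4))
  enumerate : ∀ x y → ∣ x ∣ ≤ 1 → ∣ y ∣ ≤ 1 → norm (x , y) ≡ 1ℤ → ∃ λ i → units i ≡ (x , y)
  enumerate (+ 1)    (+ 0)    _ _ _ = 0F , refl
  enumerate (+ 0)    (+ 1)    _ _ _ = 1F , refl
  enumerate -[1+ 0 ] (+ 1)    _ _ _ = 2F , refl
  enumerate -[1+ 0 ] (+ 0)    _ _ _ = 3F , refl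
  enumerate (+ 0)    -[1+ 0 ] _ _ _ = 4F , refl
  enumerate (+ 1)    -[1+ 0 ] _ _ _ = 5F , refl
  enumerate (+ 0)    (+ 0)    _ _ ()
  enumerate (+ 1)    (+ 1)    _ _ ()
  enumerate -[1+ 0 ] -[1+ 0 ] _ _ ()
  enumerate (+ suc (suc _)) _ (s≤s ()) _ _
  enumerate -[1+ suc _ ]    _ (s≤s ()) _ _
  enumerate (+ 0) (+ suc (suc _)) _ (s≤s ()) _
  enumerate (+ 1) (+ suc (suc _)) _ (s≤s ()) _
  enumerate -[1+ 0 ] (+ suc (suc _)) _ (s≤s ()) _
  enumerate (+ 0) -[1+ suc _ ] _ (s≤s ()) _
  enumerate (+ 1) -[1+ suc _ ] _ (s≤s ()) _
  enumerate -[1+ 0 ] -[1+ suc _ ] _ (s≤s ()) _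
  index : ∀ r → ∃ λ i → units i ≡ proj₁ r
  index ((x , y) , eq) = enumerate x y (small _ (norm-bound₁ {x , y} eq))
    (small _ (norm-bound₂ {x , y} eq)) eq
  to : Rep 1 → Fin 6
  to r = proj₁ (index r)
  from-units : ∀ i → proj₁ (from i) ≡ units i
  from-units 0F = refl
  from-units 1F = refl
  from-units 2F = refl
  from-units 3F = refl
  from-units 4F = refl
  from-units 5F = refl
  from∘to : ∀ r → from (to r) ≡ r
  from∘to r = Rep-≡ (trans (from-units (to r)) (proj₂ (index r)))
  to∘from : ∀ i → to (from i) ≡ i
  to∘from 0F = refl
  to∘from 1F = refl
  to∘from 2F = refl
  to∘from 3F = refl
  to∘from 4F = refl
  to∘from 5F = refl

-- Representation numbers as divisor sums

Formula : ℕ → Set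
Formula j = HasCard (Rep j) (+ 6 * σ j)

module _ {p} (pr : Prime p) where
  private instance
    p≢0 : NonZero p
    p≢0 = prime⇒nonZero pr

  data Decomposition : Set where
    ramified : p ≡ 3 → Decomposition
    split    : p ≢ 3 → χ p ≡ 1ℤ → ∀ w → norm w ≡ + p → Decomposition
    inert    : χ p ≡ -1ℤ → (∀ z → + p ∣ norm z → + p ∣² z) → Decomposition

  decomposition : Decomposition
  decomposition with mod3 p
  ... | q , inj₁ p≡ = ramified ([ (λ ()) , sym ]′ (prime⇒irreducible pr (ℕ.divides q p≡)))
  -- Here p + 1 ≡ 2 modulo 3, so the points of the projective line cannot all lie in orbits of
  -- length 3.
  ... | q , inj₂ (inj₁ p≡) =
    let z , p∣norm , p∤z = ProjectiveLine.isotropic pr (3∤ ∘ subst (λ n → 3 ℕ.∣ suc n) p≡)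
        w , norm-w = isotropic⇒norm pr {z} p∣norm p∤z
    in split (λ { refl → contradiction p≡ (3≢ q) }) (trans (cong χ p≡) (χ-+*3 1 q)) w norm-w
    where
    3∤ : ¬ 3 ℕ.∣ 2 ℕ.+ q ℕ.* 3
    3∤ d = from-no (3 ℕ.∣? 2) (ℕ.∣m+n∣m⇒∣n (subst (3 ℕ.∣_) (ℕ.+-comm 2 (q ℕ.* 3)) d) (ℕ.n∣m*n q))
    3≢ : ∀ q → 3 ≢ 1 ℕ.+ q ℕ.* 3
    3≢ zero ()
    3≢ (suc q) ()
  ... | q , inj₂ (inj₂ p≡) = inert (trans (cong χ p≡) (χ-+*3 2 q)) anisotropic
    where
    anisotropic : ∀ z → + p ∣ norm z → + p ∣² z
    anisotropic z d with (+ p ∣? proj₁ z) ×-dec (+ p ∣? proj₂ z)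
    ... | yes p∣z = p∣z
    ... | no p∤z = let w , norm-w = isotropic⇒norm pr {z} d p∤z in
      contradiction (trans norm-w (cong +_ p≡)) (norm≢2mod3 w q)

  -- For χ(p) = 0, 1, -1 the recursion for σ takes the values s, 2s - t and t, matching the counts
  -- for ramified, split and inert p.
  formula-∣ : ∀ m .{{_ : NonZero m}} → Formula m → Formula (p ℕ.* m) → Formula (p ℕ.* (p ℕ.* m))
  formula-∣ m fm fpm = by decomposition
    where
    s = σ (p ℕ.* m)
    t = σ m
    σ-χ : ∀ {x} → χ p ≡ x → + 6 * σ (p ℕ.* (p ℕ.* m)) ≡ + 6 * (s + x * (s - t))
    σ-χ refl = cong (_*_ (+ 6)) (σ-∣ pr m)
    by : Decomposition → Formula (p ℕ.* (p ℕ.* m))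
    by (ramified refl) = subst (HasCard _) (trans (identity s t) (sym (σ-χ refl))) (card-ramified fpm)
      where
      identity : ∀ s t → + 6 * s ≡ + 6 * (s + 0ℤ * (s - t))
      identity = solve-∀
    by (split p≢3 χ≡ w norm-w) = subst (HasCard _) (trans (identity s t) (sym (σ-χ χ≡)))
      (Split.card-split-∣ pr w norm-w p≢3 fpm fm)
      where
      identity : ∀ s t → + 6 * s + (+ 6 * s - + 6 * t) ≡ + 6 * (s + 1ℤ * (s - t))
      identity = solve-∀
    by (inert χ≡ anisotropic) = subst (HasCard _) (trans (identity s t) (sym (σ-χ χ≡)))
      (Inert.card-inert-∣ pr anisotropic fm)
      where
      identity : ∀ s t → + 6 * t ≡ + 6 * (s + -1ℤ * (s - t))
      identity = solve-∀

  -- For χ(p) = 0, 1, -1 the recursion gives s, 2s and 0.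
  formula-∤ : ∀ j .{{_ : NonZero j}} → ¬ p ℕ.∣ j → Formula j → Formula (p ℕ.* j)
  formula-∤ j p∤j fj = by decomposition
    where
    s = σ j
    σ-χ : ∀ {x} → χ p ≡ x → + 6 * σ (p ℕ.* j) ≡ + 6 * (s + x * s)
    σ-χ refl = cong (_*_ (+ 6)) (σ-∤ pr j p∤j)
    by : Decomposition → Formula (p ℕ.* j)
    by (ramified refl) = subst (HasCard _) (trans (identity s) (sym (σ-χ refl))) (card-ramified fj)
      where
      identity : ∀ s → + 6 * s ≡ + 6 * (s + 0ℤ * s)
      identity = solve-∀
    by (split p≢3 χ≡ w norm-w) = subst (HasCard _) (trans (identity s) (sym (σ-χ χ≡)))
      (Split.card-split-∤ pr w norm-w p≢3 p∤j fj)
      where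
      identity : ∀ s → + 6 * s + + 6 * s ≡ + 6 * (s + 1ℤ * s)
      identity = solve-∀
    by (inert χ≡ anisotropic) = subst (HasCard _) (trans (identity s) (sym (σ-χ χ≡)))
      (Inert.card-inert-∤ pr anisotropic p∤j)
      where
      identity : ∀ s → 0ℤ ≡ + 6 * (s + -1ℤ * s)
      identity = solve-∀

prime-divisor : ∀ n .{{_ : ℕ.NonTrivial n}} → ∃ λ p → ∃ λ k → Prime p × n ≡ p ℕ.* k
prime-divisor n = go (factorise n {{ℕ.nonTrivial⇒nonZero n}})
  where
  go : PrimeFactorisation n → ∃ λ p → ∃ λ k → Prime p × n ≡ p ℕ.* k
  go record { factors = [] ; isFactorisation = eq } = contradiction eq (ℕ.nonTrivial⇒≢1)
  go record { factors = p ∷ ps ; isFactorisation = eq ; factorsPrime = pr ∷ _ } =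
    p , product ps , pr , eq

-- Strong induction splits off a prime, j = pk. If p does not divide k, the formula at k suffices;
-- if k = pm, it is needed at both k and m, which are smaller than j.
formula : ∀ j .{{_ : NonZero j}} → Formula j
formula j@(suc _) = <-rec (λ j → NonZero j → Formula j) step j _
  where
  step : ∀ j → (∀ {i} → i < j → NonZero i → Formula i) → NonZero j → Formula j
  step 1 _ _ = card-Rep-1
  step j@(suc (suc _)) rec _ with prime-divisor j
  ... | p , k , pr , eq = subst Formula (sym eq) (by-cases (p ℕ.∣? k))
    where
    instance
      _ = prime⇒nonZero pr
      _ = prime⇒nonTrivial pr
      k≢0 : NonZero k
      k≢0 = ℕ.≢-nonZero λ { refl → contradiction (trans eq (ℕ.*-zeroʳ p)) (λ ()) }
    k<j : k < j
    k<j = subst (k <_) (trans (ℕ.*-comm k p) (sym eq)) (ℕ.m<m*n k p (ℕ.nonTrivial⇒n>1 p))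
    by-cases : Dec (p ℕ.∣ k) → Formula (p ℕ.* k)
    by-cases (no p∤k) = formula-∤ pr k p∤k (rec k<j k≢0)
    by-cases (yes (ℕ.divides m k≡m*p)) = subst (λ i → Formula (p ℕ.* i)) (sym k≡p*m)
        (formula-∣ pr m {{m≢0}} (rec (ℕ.≤-<-trans m≤k k<j) m≢0) (subst Formula k≡p*m (rec k<j k≢0)))
      where
      k≡p*m : k ≡ p ℕ.* m
      k≡p*m = trans k≡m*p (ℕ.*-comm m p)
      m≢0 : NonZero m
      m≢0 = ℕ.≢-nonZero λ { refl → ℕ.≢-nonZero⁻¹ k k≡m*p }
      m≤k : m ≤ k
      m≤k = subst (m ≤_) (sym k≡m*p) (ℕ.m≤m*n m p)

-- Layers of the elliptical region

EllipsePoint-≡ : ∀ {n} {r s : EllipsePoint n} → proj₁ r ≡ proj₁ s → r ≡ s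
EllipsePoint-≡ {r = _ , p} {_ , q} refl = cong (_ ,_) (ℤ.≤-irrelevant p q)

card-EllipsePoint-0 : HasCard (EllipsePoint 0) 1ℤ
card-EllipsePoint-0 = 1 , mk↔ₛ′ (λ _ → 0F) (λ _ → origin) (λ { 0F → refl ; (Fin.suc ()) })
  (λ r → EllipsePoint-≡ (sym (is-origin r))) , refl
  where
  origin : EllipsePoint 0
  origin = (0ℤ , 0ℤ) , ℤ.≤-refl
  is-origin : ∀ r → proj₁ r ≡ (0ℤ , 0ℤ)
  is-origin (z , le) = let n , eq , _ = norm-bound z in
    norm≡0⇒≡0 z (trans eq (cong +_ (ℕ.n≤0⇒n≡0 (ℤ.drop‿+≤+ (subst (ℤ._≤ 0ℤ) eq le)))))

on-boundary? : ∀ n (r : EllipsePoint (suc n)) → Dec (norm (proj₁ r) ≡ + suc n)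
on-boundary? n r = norm (proj₁ r) ℤ.≟ + suc n

boundary : ∀ n → Rep (suc n) ↔ Sat (on-boundary? n)
boundary n = mk↔ₛ′ (λ (z , eq) → (z , ℤ.≤-reflexive eq) , fromWitness eq)
  (λ (r , b) → proj₁ r , toWitness {a? = on-boundary? n r} b)
  (λ _ → Σ-True-≡ (on-boundary? n) (EllipsePoint-≡ refl)) (λ _ → Rep-≡ refl)

interior : ∀ n → EllipsePoint n ↔ Unsat (on-boundary? n)
interior n = mk↔ₛ′
  (λ (z , le) → (z , ℤ.≤-trans le (ℤ.+≤+ (ℕ.n≤1+n n)))
    , fromWitnessFalse (λ eq → ℕ.1+n≰n (ℤ.drop‿+≤+ (subst (ℤ._≤ + n) eq le))))
  (λ (r , f) → proj₁ r , ≤∧≢⇒≤pred (proj₁ r) (proj₂ r) (toWitnessFalse {a? = on-boundary? n r} f))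
  (λ _ → Σ-False-≡ (on-boundary? n) (EllipsePoint-≡ refl)) (λ _ → EllipsePoint-≡ refl)
  where
  -- The norm is first replaced by the natural number that it equals, so that the strict inequality
  -- can be lowered by one.
  ≤∧≢⇒≤pred : ∀ z → norm z ℤ.≤ + suc n → norm z ≢ + suc n → norm z ℤ.≤ + n
  ≤∧≢⇒≤pred z le ne = let m , eq , _ = norm-bound z in subst (ℤ._≤ + n) (sym eq)
    (ℤ.+≤+ (ℕ.s≤s⁻¹ (ℕ.≤∧≢⇒< (ℤ.drop‿+≤+ (subst (ℤ._≤ + suc n) eq le))
      (λ e → ne (trans eq (cong +_ e))))))

-- Passing from n to n + 1 adds the points of norm exactly n + 1, of which there are 6σ(n + 1). The
-- quotient count grows by σ(n + 1), and the origin accounts for the constant 1.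
card-EllipsePoint : ∀ n → HasCard (EllipsePoint n) (+ 6 * quotients≡1mod3 n + 1ℤ)
card-EllipsePoint zero    = card-EllipsePoint-0
card-EllipsePoint (suc n) = subst (HasCard _)
  (trans (identity (quotients≡1mod3 n) (σ (suc n)))
  (cong (λ t → + 6 * t + 1ℤ) (sym (quotients≡1mod3-suc n))))
  (card-↔ (↔-sym (↔-split (on-boundary? n)))
    (card-⊎ (card-↔ (boundary n) (formula (suc n))) (card-↔ (interior n) (card-EllipsePoint n))))
  where
  identity : ∀ t s → + 6 * s + (+ 6 * t + 1ℤ) ≡ + 6 * (t + s) + 1ℤ
  identity = solve-∀

corollary5p5 : (n : ℕ) → .{{_ : NonZero n}} →
    # EllipsePoint n ≐ (6 ℕ.* 𝒩 n 0ℚ 0ℚ 1ℤ 3 ℕ.+ 1)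
corollary5p5 n = let c , E↔ , c≡ = card-EllipsePoint n in
  subst (# EllipsePoint n ≐_) (ℤ.+-injective (begin
    + c                                  ≡⟨ c≡ ⟩
    + 6 * quotients≡1mod3 n + 1ℤ         ≡⟨ cong (λ t → + 6 * t + 1ℤ) (𝒩≡quotients≡1mod3 n) ⟨
    + 6 * + 𝒩 n 0ℚ 0ℚ 1ℤ 3 + 1ℤ          ≡⟨ cong (_+ 1ℤ) (ℤ.pos-* 6 (𝒩 n 0ℚ 0ℚ 1ℤ 3)) ⟨
    + (6 ℕ.* 𝒩 n 0ℚ 0ℚ 1ℤ 3) + 1ℤ        ≡⟨ ℤ.pos-+ _ 1 ⟨
    + (6 ℕ.* 𝒩 n 0ℚ 0ℚ 1ℤ 3 ℕ.+ 1)       ∎)) E↔
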